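{- For every topological tree $S$, $$J(S)= \lim_{d \to \infty} I_d(S).$$
   Context: A topological tree is a finite rooted tree in which every non-leaf vertex has outdegree (number of children) at least $2$; the single-vertex tree is allowed, its vertex being both root and leaf. Trees are considered up to isomorphism of rooted trees (unordered, unlabelled). $|T|$ denotes the number of leaves of $T$. A nonempty set $L$ of leaves of $T$ induces a topological tree: take the smallest subtree of $T$ connecting the leaves in $L$, rooted at the most recent common ancestor of $L$, and suppress (erase, joining the neighbours) all vertices of outdegree $1$. For topological trees $S,T$, $c(S,T)$ is the number of subsets of the leaf set of $T$ whose induced tree is isomorphic, as a rooted tree, to $S$, and $\gamma(S,T)=c(S,T)/\binom{|T|}{|S|}$ (for $|T|\ge |S|$). The inducibility of $S$ (in topological trees) is $$J(S)=\limsup_{n\to\infty}\ \max_{\substack{|T|=n\\ T\text{ topological tree}}}\gamma(S,T).$$ For an integer $d\ge 2$, a $d$-ary tree is a topological tree in which every vertex has outdegree at most $d$. For a $d$-ary tree $D$, the inducibility of $D$ in $d$-ary trees is $$I_d(D)=\lim_{n\to\infty}\ \max_{\substack{|T|=n\\ T\ d\text{ -ary tree}}}\gamma(D,T);$$ this limit is known to exist. Every topological tree $S$ is a $d$-ary tree for all sufficiently large $d$, so $I_d(S)$ is defined for all sufficiently large $d$. -}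

module Defs where

open import Data.Fin.Subset using (Subset; inside; outside)
open import Data.Integer.Base using (+_)
open import Data.List.Base as List using (List; []; _∷_; [_]; _++_; length; filter; fromMaybe)
open import Data.List.Relation.Binary.Permutation.Homogeneous as Homogeneous using (Permutation)
import Data.List.Relation.Binary.Permutation.Setoid.Properties as Permutationₚ
open import Data.List.Relation.Binary.Pointwise.Base using (Pointwise; []; _∷_)
open import Data.List.Relation.Unary.All using (All)
open import Data.List.Relation.Unary.Any using (any?)
open import Data.List.Membership.Setoid.Properties using (∈-∃++)
open import Data.Maybe.Base as Maybe using (Maybe; just; nothing)
import Data.Maybe.Relation.Unary.Any as MaybeAny
open import Data.Nat as ℕ using (ℕ; zero; suc; NonZero)
open import Data.Nat.Combinatorics using (_C_; nCk≡n!/k![n-k]!; k![n∸k]!∣n!)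
import Data.Nat.Divisibility as ℕ
import Data.Nat.DivMod as ℕ
import Data.Nat.Properties as ℕ
open import Data.Product using (_×_; _,_; ∃-syntax; Σ-syntax)
open import Data.Rational as ℚ using (ℚ; 0ℚ; ½)
import Data.Rational.Properties as ℚ
open import Data.Rational.Solver using (module +-*-Solver)
open import Data.Sum.Base using (inj₁; inj₂)
open import Data.Vec.Base using ([]; _∷_; take; drop)
open import Function.Base using (_∘_)
open import Relation.Binary.Bundles using (Setoid)
open import Relation.Binary.PropositionalEquality as ≡ using (_≡_; _≢_; refl)
open import Relation.Nullary using (Dec; yes; no)
import Relation.Nullary.Decidable as Dec

------------------------------------------------------------------------
-- Rooted trees

-- A plane representative of a finite rooted tree: a vertex with the list of
-- the subtrees at its children.  The order is forgotten by _≅_.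
data Tree : Set where
  node : List Tree → Tree

-- P holds for the outdegree of every vertex.
data EveryOutdegree (P : ℕ → Set) : Tree → Set where
  node : ∀ {ts} → P (length ts) → All (EveryOutdegree P) ts →
         EveryOutdegree P (node ts)

Topological : Tree → Set
Topological = EveryOutdegree (λ k → k ≢ 0 → 2 ℕ.≤ k)

Ary : ℕ → Tree → Set
Ary d T = Topological T × EveryOutdegree (ℕ._≤ d) T

infix 4 _≅_

data _≅_ : Tree → Tree → Set where
  node : ∀ {ts us} → Permutation _≅_ ts us → node ts ≅ node us

mutual
  ≅-refl : ∀ {t} → t ≅ t
  ≅-refl {node ts} = node (Homogeneous.refl (≅-refl* ts))

  ≅-refl* : ∀ ts → Pointwise _≅_ ts ts
  ≅-refl* []       = []
  ≅-refl* (t ∷ ts) = ≅-refl ∷ ≅-refl* ts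

mutual
  ≅-sym : ∀ {t u} → t ≅ u → u ≅ t
  ≅-sym (node p) = node (↭-sym p)

  ↭-sym : ∀ {ts us} → Permutation _≅_ ts us → Permutation _≅_ us ts
  ↭-sym (Homogeneous.refl ps)    = Homogeneous.refl (≋-sym ps)
  ↭-sym (Homogeneous.prep e p)   = Homogeneous.prep (≅-sym e) (↭-sym p)
  ↭-sym (Homogeneous.swap e f p) = Homogeneous.swap (≅-sym f) (≅-sym e) (↭-sym p)
  ↭-sym (Homogeneous.trans p q)  = Homogeneous.trans (↭-sym q) (↭-sym p)

  ≋-sym : ∀ {ts us} → Pointwise _≅_ ts us → Pointwise _≅_ us ts
  ≋-sym []       = []
  ≋-sym (e ∷ es) = ≅-sym e ∷ ≋-sym es

≅-trans : ∀ {t u v} → t ≅ u → u ≅ v → t ≅ v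
≅-trans (node p) (node q) = node (Homogeneous.trans p q)

≅-setoid : Setoid _ _
≅-setoid = record
  { Carrier       = Tree
  ; _≈_           = _≅_
  ; isEquivalence = record { refl = ≅-refl ; sym = ≅-sym ; trans = ≅-trans }
  }

private
  module ↭ = Permutationₚ ≅-setoid

infix 4 _≅?_ _↭?_

mutual
  _≅?_ : ∀ t u → Dec (t ≅ u)
  node ts ≅? node us = Dec.map′ node (λ { (node p) → p }) (ts ↭? us)

  _↭?_ : ∀ ts us → Dec (Permutation _≅_ ts us)
  []       ↭? []       = yes (Homogeneous.refl [])
  []       ↭? (u ∷ us) = no (↭.¬x∷xs↭[] ∘ ↭-sym)
  (t ∷ ts) ↭? us with any? (t ≅?_) us
  ... | no  t∉us = no (λ p → t∉us (↭.∈-resp-↭ p (Any.here ≅-refl)))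
    where import Data.List.Relation.Unary.Any as Any
  ... | yes t∈us with ∈-∃++ ≅-setoid t∈us
  ... | as , bs , w , t≅w , us≋ = Dec.map′ to from (ts ↭? as ++ bs)
    where
    us↭ : Permutation _≅_ us (t ∷ as ++ bs)
    us↭ = Homogeneous.trans (Homogeneous.refl us≋) (↭.shift (≅-sym t≅w) as bs)

    to : Permutation _≅_ ts (as ++ bs) → Permutation _≅_ (t ∷ ts) us
    to p = Homogeneous.trans (Homogeneous.prep ≅-refl p) (↭-sym us↭)

    from : Permutation _≅_ (t ∷ ts) us → Permutation _≅_ ts (as ++ bs)
    from p = ↭.drop-∷ (Homogeneous.trans p us↭)

------------------------------------------------------------------------
-- Leaves and induced trees

-- The leaves of T are numbered from left to right, so that a set of leaves is
-- a Subset (leaves T).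
mutual
  leaves : Tree → ℕ
  leaves (node [])       = 1
  leaves (node (t ∷ ts)) = leaves* (t ∷ ts)

  leaves* : List Tree → ℕ
  leaves* []       = 0
  leaves* (t ∷ ts) = leaves t ℕ.+ leaves* ts

-- The subtree formed by the vertices with at least one descendant in the given
-- set of leaves (where a vertex is a descendant of itself); nothing if the set
-- is empty.
mutual
  prune : ∀ T → Subset (leaves T) → Maybe Tree
  prune (node [])       (inside  ∷ []) = just (node [])
  prune (node [])       (outside ∷ []) = nothing
  prune (node (t ∷ ts)) L with prune* (t ∷ ts) L
  ... | []     = nothing
  ... | u ∷ us = just (node (u ∷ us))

  prune* : ∀ ts → Subset (leaves* ts) → List Tree
  prune* []       L = []
  prune* (t ∷ ts) L =
    fromMaybe (prune t (take (leaves t) L)) ++ prune* ts (drop (leaves t) L)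

-- In a pruned tree, the most recent common ancestor of the leaves is reached
-- from the root by descending as long as there is only one child.
atMRCA : Tree → Tree
atMRCA (node [])           = node []
atMRCA (node (t ∷ []))     = atMRCA t
atMRCA (node (t ∷ u ∷ ts)) = node (t ∷ u ∷ ts)

mutual
  suppress : Tree → Tree
  suppress (node [])           = node []
  suppress (node (t ∷ []))     = suppress t
  suppress (node (t ∷ u ∷ ts)) = node (suppress* (t ∷ u ∷ ts))

  suppress* : List Tree → List Tree
  suppress* []       = []
  suppress* (t ∷ ts) = suppress t ∷ suppress* ts

induced : ∀ T → Subset (leaves T) → Maybe Tree
induced T L = Maybe.map (suppress ∘ atMRCA) (prune T L)

-- L is nonempty and induces a tree isomorphic to S.
Induces : ∀ T → Subset (leaves T) → Tree → Set
Induces T L S = MaybeAny.Any (_≅ S) (induced T L)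

subsets : ∀ n → List (Subset n)
subsets zero    = [ [] ]
subsets (suc n) = List.map (inside ∷_) (subsets n) ++ List.map (outside ∷_) (subsets n)

c : Tree → Tree → ℕ
c S T = length (filter (λ L → MaybeAny.dec (_≅? S) (induced T L)) (subsets (leaves T)))

nCk≢0 : ∀ {n k} → k ℕ.≤ n → NonZero (n C k)
nCk≢0 {n} {k} k≤n rewrite nCk≡n!/k![n-k]! k≤n =
  ℕ.>-nonZero (ℕ.m≥n⇒m/n>0 (ℕ.∣⇒≤ (k![n∸k]!∣n! k≤n)))
  where instance
    _ = n ℕ.!≢0
    _ = k ℕ.!* (n ℕ.∸ k) !≢0

γ : ∀ S T → .(leaves S ℕ.≤ leaves T) → ℚ
γ S T S≤T = ℚ._/_ (+ c S T) (leaves T C leaves S) {{nCk≢0 S≤T}}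

------------------------------------------------------------------------
-- Real numbers, as Cauchy sequences of rationals

record ℝ : Set where
  field
    seq    : ℕ → ℚ
    cauchy : ∀ ε → 0ℚ ℚ.< ε → ∃[ N ] ∀ m n → N ℕ.≤ m → N ℕ.≤ n →
             ℚ.∣ seq m ℚ.- seq n ∣ ℚ.< ε
open ℝ public

private
  ½* : ∀ {ε} → 0ℚ ℚ.< ε → 0ℚ ℚ.< ½ ℚ.* ε
  ½* {ε} 0<ε = ℚ.positive⁻¹ (½ ℚ.* ε) {{ℚ.pos*pos⇒pos ½ ε {{ℚ.positive 0<ε}}}}

  ½+½ : ∀ ε → ½ ℚ.* ε ℚ.+ ½ ℚ.* ε ≡ ε
  ½+½ = solve 1 (λ e → con ½ :* e :+ con ½ :* e := e) refl
    where open +-*-Solver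

  ∣-∣-interchange : ∀ a b c d → ℚ.∣ (a ℚ.- b) ℚ.- (c ℚ.- d) ∣ ℚ.≤
                                ℚ.∣ a ℚ.- c ∣ ℚ.+ ℚ.∣ b ℚ.- d ∣
  ∣-∣-interchange a b c d =
    ≡.subst (λ x → ℚ.∣ x ∣ ℚ.≤ ℚ.∣ a ℚ.- c ∣ ℚ.+ ℚ.∣ b ℚ.- d ∣)
      (solve 4 (λ a b c d → (a :- c) :- (b :- d) := (a :- b) :- (c :- d)) refl a b c d)
      (ℚ.∣p-q∣≤∣p∣+∣q∣ (a ℚ.- c) (b ℚ.- d))
    where open +-*-Solver

  ∣p∣-∣q∣≤∣p-q∣ : ∀ p q → ℚ.∣ p ∣ ℚ.- ℚ.∣ q ∣ ℚ.≤ ℚ.∣ p ℚ.- q ∣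
  ∣p∣-∣q∣≤∣p-q∣ p q = begin
    ℚ.∣ p ∣ ℚ.- ℚ.∣ q ∣
      ≡⟨ ≡.cong (λ x → ℚ.∣ x ∣ ℚ.- ℚ.∣ q ∣)
           (solve 2 (λ p q → p := (p :- q) :+ q) refl p q) ⟩
    ℚ.∣ (p ℚ.- q) ℚ.+ q ∣ ℚ.- ℚ.∣ q ∣
      ≤⟨ ℚ.+-monoˡ-≤ (ℚ.- ℚ.∣ q ∣) (ℚ.∣p+q∣≤∣p∣+∣q∣ (p ℚ.- q) q) ⟩
    (ℚ.∣ p ℚ.- q ∣ ℚ.+ ℚ.∣ q ∣) ℚ.- ℚ.∣ q ∣
      ≡⟨ solve 2 (λ x y → (x :+ y) :- y := x) refl ℚ.∣ p ℚ.- q ∣ ℚ.∣ q ∣ ⟩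
    ℚ.∣ p ℚ.- q ∣ ∎
    where
    open +-*-Solver
    open ℚ.≤-Reasoning

  ∣-∣-swap : ∀ p q → ℚ.∣ q ℚ.- p ∣ ≡ ℚ.∣ p ℚ.- q ∣
  ∣-∣-swap p q = ≡.trans
    (≡.cong ℚ.∣_∣ (solve 2 (λ p q → q :- p := :- (p :- q)) refl p q))
    (ℚ.∣-p∣≡∣p∣ (p ℚ.- q))
    where open +-*-Solver

  ∣∣p∣-∣q∣∣≤∣p-q∣ : ∀ p q → ℚ.∣ ℚ.∣ p ∣ ℚ.- ℚ.∣ q ∣ ∣ ℚ.≤ ℚ.∣ p ℚ.- q ∣
  ∣∣p∣-∣q∣∣≤∣p-q∣ p q with ℚ.∣p∣≡p∨∣p∣≡-p (ℚ.∣ p ∣ ℚ.- ℚ.∣ q ∣)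
  ... | inj₁ eq rewrite eq = ∣p∣-∣q∣≤∣p-q∣ p q
  ... | inj₂ eq rewrite eq = begin
    ℚ.- (ℚ.∣ p ∣ ℚ.- ℚ.∣ q ∣)
      ≡⟨ solve 2 (λ x y → :- (x :- y) := y :- x) refl ℚ.∣ p ∣ ℚ.∣ q ∣ ⟩
    ℚ.∣ q ∣ ℚ.- ℚ.∣ p ∣
      ≤⟨ ∣p∣-∣q∣≤∣p-q∣ q p ⟩
    ℚ.∣ q ℚ.- p ∣
      ≡⟨ ∣-∣-swap p q ⟩
    ℚ.∣ p ℚ.- q ∣ ∎
    where
    open +-*-Solver
    open ℚ.≤-Reasoning

fromℚ : ℚ → ℝ
seq    (fromℚ q) _ = q
cauchy (fromℚ q) ε 0<ε =
  0 , λ _ _ _ _ → ≡.subst (λ x → ℚ.∣ x ∣ ℚ.< ε) (≡.sym (ℚ.+-inverseʳ q)) 0<ε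

infixl 6 _-_
infix  4 _<_

_-_ : ℝ → ℝ → ℝ
seq    (x - y) n = seq x n ℚ.- seq y n
cauchy (x - y) ε 0<ε with cauchy x (½ ℚ.* ε) (½* 0<ε) | cauchy y (½ ℚ.* ε) (½* 0<ε)
... | M , x-cauchy | N , y-cauchy = M ℕ.⊔ N , λ m n ≤m ≤n →
  ℚ.≤-<-trans (∣-∣-interchange (seq x m) (seq y m) (seq x n) (seq y n))
    (≡.subst (_ ℚ.<_) (½+½ ε)
      (ℚ.+-mono-<
        (x-cauchy m n (ℕ.m⊔n≤o⇒m≤o M N ≤m) (ℕ.m⊔n≤o⇒m≤o M N ≤n))
        (y-cauchy m n (ℕ.m⊔n≤o⇒n≤o M N ≤m) (ℕ.m⊔n≤o⇒n≤o M N ≤n))))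

∣_∣ : ℝ → ℝ
seq    ∣ x ∣ n = ℚ.∣ seq x n ∣
cauchy ∣ x ∣ ε 0<ε with cauchy x ε 0<ε
... | N , x-cauchy = N , λ m n ≤m ≤n →
  ℚ.≤-<-trans (∣∣p∣-∣q∣∣≤∣p-q∣ (seq x m) (seq x n)) (x-cauchy m n ≤m ≤n)

_<_ : ℝ → ℝ → Set
x < y = ∃[ δ ] (0ℚ ℚ.< δ) × ∃[ N ] ∀ n → N ℕ.≤ n → seq x n ℚ.+ δ ℚ.≤ seq y n

IsLimit : (ℕ → ℝ) → ℝ → Set
IsLimit a ℓ = ∀ ε → 0ℚ ℚ.< ε → ∃[ N ] ∀ n → N ℕ.≤ n → ∣ a n - ℓ ∣ < fromℚ ε

IsLimsup : (ℕ → ℝ) → ℝ → Set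
IsLimsup a ℓ = ∀ ε → 0ℚ ℚ.< ε →
  (∃[ N ] ∀ n → N ℕ.≤ n → a n - ℓ < fromℚ ε) ×
  (∀ N → ∃[ n ] N ℕ.≤ n × ℓ - a n < fromℚ ε)

------------------------------------------------------------------------
-- Inducibility

-- m is the maximum of γ S T over the trees T in the class P with n leaves.
IsMaxDensity : (P : Tree → Set) → Tree → ℕ → ℚ → Set
IsMaxDensity P S n m =
  (∃[ T ] P T × leaves T ≡ n × Σ[ S≤T ∈ leaves S ℕ.≤ leaves T ] γ S T S≤T ≡ m) ×
  (∀ T → P T → leaves T ≡ n → (S≤T : leaves S ℕ.≤ leaves T) → γ S T S≤T ℚ.≤ m)

-- The densities are only defined for n ≥ leaves S; the earlier terms of a are
-- arbitrary and do not affect the limit superior or the limit.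
IsMaxDensitySequence : (P : Tree → Set) → Tree → (ℕ → ℚ) → Set
IsMaxDensitySequence P S a = ∀ n → leaves S ℕ.≤ n → IsMaxDensity P S n (a n)

-- J is the inducibility J(S).
IsInducibility : Tree → ℝ → Set
IsInducibility S J = ∃[ a ] IsMaxDensitySequence Topological S a × IsLimsup (fromℚ ∘ a) J

-- I is the inducibility I_d(S) in d-ary trees.
IsAryInducibility : ℕ → Tree → ℝ → Set
IsAryInducibility d S I = ∃[ a ] IsMaxDensitySequence (Ary d) S a × IsLimit (fromℚ ∘ a) I

-- Let a(n) be the maximal density of S, with k leaves, in the trees with n
-- leaves of a class closed under deleting leaves and under grafting.  Averaging
-- over the deletions of one leaf shows that a(n) is nonincreasing for n ≥ k.
-- Grafting a tree with q leaves on every leaf of T multiplies c(S,T) by at least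
-- q^k, so a(n) (1 - k²/n) ≤ a(nq) for all q.  Hence 0 ≤ a(m) - a(n) ≤ K/m for
-- k ≤ m ≤ n, where K depends only on S and not on the class.  This gives the
-- limits with an explicit rate, uniformly in d.  Since every topological tree
-- with at most d leaves is d-ary, the d-ary and the unrestricted sequences agree
-- up to n = d, so that their limits differ by at most K/d.

module Submission where

open import Defs
open import Data.Bool.Base using (true; false; if_then_else_)
open import Data.Fin.Subset using (Subset; inside; outside)
open import Data.Integer.Base as ℤ using (+≤+)
import Data.Integer.Properties as ℤ
open import Data.List.Base using (List; []; _∷_; [_]; _++_; length; map; filter; fromMaybe; cartesianProductWith)
open import Data.List.Extrema.Nat using (argmax; argmax-all; f[xs]≤f[argmax])
open import Data.List.Membership.Propositional using (_∈_)
open import Data.List.Membership.Propositional.Properties using (∈-map⁺; ∈-filter⁺; ∈-cartesianProductWith⁺)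
open import Data.List.Properties using (length-++; length-map; length-filter)
open import Data.List.Relation.Binary.Permutation.Homogeneous as Homogeneous using (Permutation)
open import Data.List.Relation.Binary.Pointwise.Base using (Pointwise; []; _∷_)
open import Data.List.Relation.Unary.All as All using (All; []; _∷_)
import Data.List.Relation.Unary.All.Properties as All
open import Data.List.Relation.Unary.Any using (here; there)
open import Data.Maybe.Base as Maybe using (Maybe; just; nothing; maybe′)
import Data.Maybe.Relation.Unary.All as MaybeAll
import Data.Maybe.Relation.Unary.Any as MaybeAny
open import Data.Nat using (ℕ; zero; suc; _+_; _*_; _^_; _!; _⊔_; _≤_; z≤n; s≤s; s≤s⁻¹; _≤′_; ≤′-refl; ≤′-step; NonZero; _≤?_; _≟_)
open import Data.Nat.Combinatorics using (_C_; nCk+nC[k+1]≡[n+1]C[k+1]; nCn≡1; nC1≡n; k>n⇒nCk≡0)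
open import Data.Nat.ListAction using (sum)
open import Data.Nat.Properties
open import Data.Nat.Solver using (module +-*-Solver)
open import Data.Product using (_×_; _,_; proj₁; proj₂; ∃-syntax; Σ-syntax)
open import Data.Rational as ℚ using (ℚ; mkℚ; 0ℚ; ½)
import Data.Rational.Properties as ℚ
open import Data.Rational.Solver using () renaming (module +-*-Solver to ℚ-Solver)
open import Data.Rational.Unnormalised as ℚᵘ using (mkℚᵘ; *≤*)
import Data.Rational.Unnormalised.Properties as ℚᵘ
open import Data.Sum.Base using (inj₁; inj₂)
open import Data.Vec.Base as Vec using ([]; _∷_; take; drop)
open import Function.Base using (_∘_; id)
open import Relation.Binary.PropositionalEquality using (_≡_; _≢_; refl; sym; trans; cong; cong₂; subst; subst₂; module ≡-Reasoning)
open import Relation.Nullary using (Dec; yes; no; does; contradiction; ¬?; _×-dec_; _→-dec_)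
open import Relation.Nullary.Decidable using (map′)
open import Algebra.Properties.CommutativeSemigroup +-commutativeSemigroup using (x∙yz≈y∙xz)
open import Algebra.Properties.CommutativeSemigroup *-commutativeSemigroup using (xy∙z≈xz∙y)

-- Finite sums

private
  variable
    X Y Z : Set

∑ : List X → (X → ℕ) → ℕ
∑ xs f = sum (map f xs)

infix 5 ∑
syntax ∑ xs (λ x → e) = ∑[ x ∈ xs ] e

∑-++ : ∀ (xs ys : List X) f → ∑ (xs ++ ys) f ≡ ∑ xs f + ∑ ys f
∑-++ []       ys f = refl
∑-++ (x ∷ xs) ys f = trans (cong (f x +_) (∑-++ xs ys f)) (sym (+-assoc (f x) _ _))

∑-map : ∀ (g : X → Y) xs f → ∑ (map g xs) f ≡ ∑ xs (f ∘ g)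
∑-map g []       f = refl
∑-map g (x ∷ xs) f = cong (f (g x) +_) (∑-map g xs f)

∑-cong : ∀ (xs : List X) {f g : X → ℕ} → (∀ x → f x ≡ g x) → ∑ xs f ≡ ∑ xs g
∑-cong []       f≗g = refl
∑-cong (x ∷ xs) f≗g = cong₂ _+_ (f≗g x) (∑-cong xs f≗g)

∑-mono : ∀ (xs : List X) {f g : X → ℕ} → (∀ x → f x ≤ g x) → ∑ xs f ≤ ∑ xs g
∑-mono []       f≤g = z≤n
∑-mono (x ∷ xs) f≤g = +-mono-≤ (f≤g x) (∑-mono xs f≤g)

∑-bounded : ∀ {xs : List X} {f : X → ℕ} {b} → All (λ x → f x ≤ b) xs → ∑ xs f ≤ length xs * b
∑-bounded []       = z≤n
∑-bounded (p ∷ ps) = +-mono-≤ p (∑-bounded ps)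

∑-distrib-+ : ∀ (xs : List X) f g → (∑[ x ∈ xs ] (f x + g x)) ≡ ∑ xs f + ∑ xs g
∑-distrib-+ []       f g = refl
∑-distrib-+ (x ∷ xs) f g = trans (cong (f x + g x +_) (∑-distrib-+ xs f g))
  (solve 4 (λ a b c d → a :+ b :+ (c :+ d) := a :+ c :+ (b :+ d)) refl (f x) (g x) (∑ xs f) (∑ xs g))
  where open +-*-Solver

∑-distribˡ-* : ∀ (xs : List X) k f → (∑[ x ∈ xs ] (k * f x)) ≡ k * ∑ xs f
∑-distribˡ-* []       k f = sym (*-zeroʳ k)
∑-distribˡ-* (x ∷ xs) k f = trans (cong (k * f x +_) (∑-distribˡ-* xs k f)) (sym (*-distribˡ-+ k (f x) _))

∑-zero : ∀ (xs : List X) → (∑[ x ∈ xs ] 0) ≡ 0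
∑-zero []       = refl
∑-zero (x ∷ xs) = ∑-zero xs

∑-swap : ∀ (xs : List X) (ys : List Y) (f : X → Y → ℕ) →
         (∑[ x ∈ xs ] ∑[ y ∈ ys ] f x y) ≡ (∑[ y ∈ ys ] ∑[ x ∈ xs ] f x y)
∑-swap []       ys f = sym (∑-zero ys)
∑-swap (x ∷ xs) ys f = trans (cong (∑ ys (f x) +_) (∑-swap xs ys f))
  (sym (∑-distrib-+ ys (f x) (λ y → ∑[ x ∈ xs ] f x y)))

∑-cartesianProductWith : ∀ (g : X → Y → Z) xs ys f →
  ∑ (cartesianProductWith g xs ys) f ≡ (∑[ x ∈ xs ] ∑[ y ∈ ys ] f (g x y))
∑-cartesianProductWith g []       ys f = refl
∑-cartesianProductWith g (x ∷ xs) ys f =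
  trans (∑-++ (map (g x) ys) (cartesianProductWith g xs ys) f)
        (cong₂ _+_ (∑-map (g x) ys f) (∑-cartesianProductWith g xs ys f))

indicator : ∀ {P : Set} → Dec P → ℕ
indicator P? = if does P? then 1 else 0

length-filter≡∑ : ∀ {P : X → Set} (P? : ∀ x → Dec (P x)) xs →
                  length (filter P? xs) ≡ ∑ xs (λ x → indicator (P? x))
length-filter≡∑ P? []       = refl
length-filter≡∑ P? (x ∷ xs) with does (P? x)
... | true  = cong suc (length-filter≡∑ P? xs)
... | false = length-filter≡∑ P? xs

-- Induced trees

-- A set of leaves of a forest `t ∷ ts` is a pair of independent choices, in `t` and in `ts`; this
-- is the split that `prune*` makes with `take` and `drop`.
∑-subsets-+ : ∀ m n (f : Subset (m + n) → ℕ) →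
  ∑ (subsets (m + n)) f ≡ (∑[ K ∈ subsets m ] ∑[ L ∈ subsets n ] f (K Vec.++ L))
∑-subsets-+ zero    n f = sym (+-identityʳ _)
∑-subsets-+ (suc m) n f = begin
  ∑ (map (inside ∷_) (subsets (m + n)) ++ map (outside ∷_) (subsets (m + n))) f
    ≡⟨ ∑-++ (map (inside ∷_) (subsets (m + n))) _ f ⟩
  ∑ (map (inside ∷_) (subsets (m + n))) f + ∑ (map (outside ∷_) (subsets (m + n))) f
    ≡⟨ cong₂ _+_ (half inside) (half outside) ⟩
  ∑ (map (inside ∷_) (subsets m)) g + ∑ (map (outside ∷_) (subsets m)) g
    ≡⟨ ∑-++ (map (inside ∷_) (subsets m)) _ g ⟨
  ∑ (map (inside ∷_) (subsets m) ++ map (outside ∷_) (subsets m)) g ∎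
  where
  open ≡-Reasoning
  g : Subset (suc m) → ℕ
  g K = ∑[ L ∈ subsets n ] f (K Vec.++ L)

  half : ∀ s → ∑ (map (s ∷_) (subsets (m + n))) f ≡ ∑ (map (s ∷_) (subsets m)) g
  half s = trans (∑-map (s ∷_) (subsets (m + n)) f)
    (trans (∑-subsets-+ m n (f ∘ (s ∷_))) (sym (∑-map (s ∷_) (subsets m) g)))

take-++ : ∀ {m n} (K : Subset m) (L : Subset n) → take m (K Vec.++ L) ≡ K
take-++ []      L = refl
take-++ (s ∷ K) L = cong (s ∷_) (take-++ K L)

drop-++ : ∀ {m n} (K : Subset m) (L : Subset n) → drop m (K Vec.++ L) ≡ L
drop-++ []      L = refl
drop-++ (s ∷ K) L = drop-++ K L

-- The tree induced by a set of leaves is the join of the trees induced in the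
-- subtrees at the children, with nothing for the empty set.
join : List Tree → Maybe Tree
join []           = nothing
join (t ∷ [])     = just t
join (t ∷ u ∷ ts) = just (node (t ∷ u ∷ ts))

infixr 5 _?∷_

_?∷_ : Maybe Tree → List Tree → List Tree
t ?∷ ts = fromMaybe t ++ ts

mutual
  -- One entry for each set of leaves, so that sums over this list count with multiplicity. Vertices
  -- of outdegree 1 are suppressed on the way up by `join`, which makes the recursion purely
  -- structural.
  inducedTrees : Tree → List (Maybe Tree)
  inducedTrees (node [])       = just (node []) ∷ nothing ∷ []
  inducedTrees (node (t ∷ ts)) = map join (inducedTrees* (t ∷ ts))

  inducedTrees* : List Tree → List (List Tree)
  inducedTrees* []       = [ [] ]
  inducedTrees* (t ∷ ts) = cartesianProductWith _?∷_ (inducedTrees t) (inducedTrees* ts)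

-- The empty tree still has one set of leaves, the empty set.
inducedTreesᴹ : Maybe Tree → List (Maybe Tree)
inducedTreesᴹ = maybe′ inducedTrees [ nothing ]

leavesᴹ : Maybe Tree → ℕ
leavesᴹ = maybe′ leaves 0

-- `suppress` itself descends through single children at the root, so the passage to the most recent
-- common ancestor is absorbed.
suppress-atMRCA : ∀ T → suppress (atMRCA T) ≡ suppress T
suppress-atMRCA (node [])           = refl
suppress-atMRCA (node (t ∷ []))     = suppress-atMRCA t
suppress-atMRCA (node (t ∷ u ∷ ts)) = refl

induced≡suppress : ∀ T L → induced T L ≡ Maybe.map suppress (prune T L)
induced≡suppress T L with prune T L
... | just U  = cong just (suppress-atMRCA U)
... | nothing = refl

-- The cases of `join` are the numbers of surviving children: with none the vertex vanishes, with
-- one it is suppressed, with two or more it stays.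
suppress-prune : ∀ t ts L →
  Maybe.map suppress (prune (node (t ∷ ts)) L) ≡ join (suppress* (prune* (t ∷ ts) L))
suppress-prune t ts L with prune* (t ∷ ts) L
... | []         = refl
... | _ ∷ []     = refl
... | _ ∷ _ ∷ _  = refl

suppress*-?∷ : ∀ t ts → suppress* (t ?∷ ts) ≡ Maybe.map suppress t ?∷ suppress* ts
suppress*-?∷ (just _) ts = refl
suppress*-?∷ nothing  ts = refl

mutual
  -- The weight `f` is arbitrary for the sake of the induction: in the step for `t ∷ ts`, the
  -- hypothesis for `t` is applied to a weight that is itself a sum over the selections in `ts`.
  ∑-prune : ∀ T f → (∑[ L ∈ subsets (leaves T) ] f (Maybe.map suppress (prune T L)))
                  ≡ ∑ (inducedTrees T) f
  ∑-prune (node [])       f = refl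
  ∑-prune (node (t ∷ ts)) f = begin
    (∑[ L ∈ subsets (leaves* (t ∷ ts)) ] f (Maybe.map suppress (prune (node (t ∷ ts)) L)))
      ≡⟨ ∑-cong (subsets (leaves* (t ∷ ts))) (λ L → cong f (suppress-prune t ts L)) ⟩
    (∑[ L ∈ subsets (leaves* (t ∷ ts)) ] f (join (suppress* (prune* (t ∷ ts) L))))
      ≡⟨ ∑-prune* (t ∷ ts) (f ∘ join) ⟩
    ∑ (inducedTrees* (t ∷ ts)) (f ∘ join)
      ≡⟨ ∑-map join (inducedTrees* (t ∷ ts)) f ⟨
    ∑ (inducedTrees (node (t ∷ ts))) f ∎
    where open ≡-Reasoning

  ∑-prune* : ∀ ts f → (∑[ L ∈ subsets (leaves* ts) ] f (suppress* (prune* ts L)))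
                    ≡ ∑ (inducedTrees* ts) f
  ∑-prune* []       f = refl
  ∑-prune* (t ∷ ts) f = begin
    (∑[ L ∈ subsets (leaves t + leaves* ts) ] f (suppress* (prune* (t ∷ ts) L)))
      ≡⟨ ∑-subsets-+ (leaves t) (leaves* ts) _ ⟩
    (∑[ K ∈ subsets (leaves t) ] ∑[ L ∈ subsets (leaves* ts) ]
      f (suppress* (prune* (t ∷ ts) (K Vec.++ L))))
      ≡⟨ ∑-cong (subsets (leaves t)) (λ K → ∑-cong (subsets (leaves* ts)) (λ L → cong f (split K L))) ⟩
    (∑[ K ∈ subsets (leaves t) ] ∑[ L ∈ subsets (leaves* ts) ]
      f (Maybe.map suppress (prune t K) ?∷ suppress* (prune* ts L)))
      ≡⟨ ∑-cong (subsets (leaves t)) (λ K → ∑-prune* ts _) ⟩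
    (∑[ K ∈ subsets (leaves t) ] ∑[ us ∈ inducedTrees* ts ]
      f (Maybe.map suppress (prune t K) ?∷ us))
      ≡⟨ ∑-prune t _ ⟩
    (∑[ u ∈ inducedTrees t ] ∑[ us ∈ inducedTrees* ts ] f (u ?∷ us))
      ≡⟨ ∑-cartesianProductWith _?∷_ (inducedTrees t) (inducedTrees* ts) f ⟨
    ∑ (inducedTrees* (t ∷ ts)) f ∎
    where
    open ≡-Reasoning
    split : ∀ K L → suppress* (prune* (t ∷ ts) (K Vec.++ L))
                  ≡ Maybe.map suppress (prune t K) ?∷ suppress* (prune* ts L)
    split K L = trans
      (cong₂ (λ K L → suppress* (prune t K ?∷ prune* ts L)) (take-++ K L) (drop-++ K L))
      (suppress*-?∷ (prune t K) (prune* ts L))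

occurs : Tree → Maybe Tree → ℕ
occurs S U = indicator (MaybeAny.dec (_≅? S) U)

c≡∑ : ∀ S T → c S T ≡ ∑ (inducedTrees T) (occurs S)
c≡∑ S T = begin
  length (filter (λ L → MaybeAny.dec (_≅? S) (induced T L)) (subsets (leaves T)))
    ≡⟨ length-filter≡∑ (λ L → MaybeAny.dec (_≅? S) (induced T L)) (subsets (leaves T)) ⟩
  (∑[ L ∈ subsets (leaves T) ] occurs S (induced T L))
    ≡⟨ ∑-cong (subsets (leaves T)) (λ L → cong (occurs S) (induced≡suppress T L)) ⟩
  (∑[ L ∈ subsets (leaves T) ] occurs S (Maybe.map suppress (prune T L)))
    ≡⟨ ∑-prune T (occurs S) ⟩
  ∑ (inducedTrees T) (occurs S) ∎
  where open ≡-Reasoning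

leaves≥1 : ∀ T → 1 ≤ leaves T
leaves≥1 (node [])       = ≤-refl
leaves≥1 (node (t ∷ ts)) = ≤-trans (leaves≥1 t) (m≤m+n (leaves t) (leaves* ts))

leaves*≢0 : ∀ t ts → leaves* (t ∷ ts) ≢ 0
leaves*≢0 t ts = m<n⇒n≢0 (leaves≥1 (node (t ∷ ts)))

-- A childless vertex counts as a leaf although `leaves* []` is 0, so `leaves` is not simply
-- `leaves*` of the children. The mixed cases are impossible because a nonempty forest has a leaf.
leaves-node : ∀ ts us → leaves* ts ≡ leaves* us → leaves (node ts) ≡ leaves (node us)
leaves-node []       []       eq = refl
leaves-node []       (u ∷ us) eq = contradiction (sym eq) (leaves*≢0 u us)
leaves-node (t ∷ ts) []       eq = contradiction eq (leaves*≢0 t ts)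
leaves-node (t ∷ ts) (u ∷ us) eq = eq

mutual
  leaves-cong : ∀ {T U} → T ≅ U → leaves T ≡ leaves U
  leaves-cong (node {ts} {us} p) = leaves-node ts us (leaves*-cong p)

  leaves*-cong : ∀ {ts us} → Permutation _≅_ ts us → leaves* ts ≡ leaves* us
  leaves*-cong (Homogeneous.refl es)   = leaves*-cong-≋ es
  leaves*-cong (Homogeneous.prep e p)  = cong₂ _+_ (leaves-cong e) (leaves*-cong p)
  leaves*-cong (Homogeneous.swap {x′ = t′} {u′} e f p) =
    trans (cong₂ _+_ (leaves-cong e) (cong₂ _+_ (leaves-cong f) (leaves*-cong p)))
          (x∙yz≈y∙xz (leaves t′) (leaves u′) _)
  leaves*-cong (Homogeneous.trans p q) = trans (leaves*-cong p) (leaves*-cong q)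

  leaves*-cong-≋ : ∀ {ts us} → Pointwise _≅_ ts us → leaves* ts ≡ leaves* us
  leaves*-cong-≋ []       = refl
  leaves*-cong-≋ (e ∷ es) = cong₂ _+_ (leaves-cong e) (leaves*-cong-≋ es)

-- Only trees isomorphic to `S` have nonzero weight, and isomorphic trees have equally many leaves.
leavesᴹ*occurs : ∀ S U → leavesᴹ U * occurs S U ≡ leaves S * occurs S U
leavesᴹ*occurs S nothing = sym (*-zeroʳ (leaves S))
leavesᴹ*occurs S (just U) with U ≅? S
... | yes U≅S = cong (_* 1) (leaves-cong U≅S)
... | no  _   = trans (*-zeroʳ (leaves U)) (sym (*-zeroʳ (leaves S)))

-- Deleting one leaf

mutual
  -- One entry for each leaf; `join` suppresses the parent if a single child remains, so the results
  -- are again topological.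
  deletions : Tree → List (Maybe Tree)
  deletions (node [])       = [ nothing ]
  deletions (node (t ∷ ts)) = map join (deletions* (t ∷ ts))

  deletions* : List Tree → List (List Tree)
  deletions* []       = []
  deletions* (t ∷ ts) = map (_?∷ ts) (deletions t) ++ map (t ∷_) (deletions* ts)

mutual
  length-deletions : ∀ T → length (deletions T) ≡ leaves T
  length-deletions (node [])       = refl
  length-deletions (node (t ∷ ts)) =
    trans (length-map join (deletions* (t ∷ ts))) (length-deletions* (t ∷ ts))

  length-deletions* : ∀ ts → length (deletions* ts) ≡ leaves* ts
  length-deletions* []       = refl
  length-deletions* (t ∷ ts) = trans (length-++ (map (_?∷ ts) (deletions t)))
    (cong₂ _+_ (trans (length-map _ (deletions t)) (length-deletions t))
               (trans (length-map _ (deletions* ts)) (length-deletions* ts)))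

leavesᴹ-join : ∀ ts → leavesᴹ (join ts) ≡ leaves* ts
leavesᴹ-join []           = refl
leavesᴹ-join (t ∷ [])     = sym (+-identityʳ (leaves t))
leavesᴹ-join (t ∷ u ∷ ts) = refl

leaves*-?∷ : ∀ t ts → leaves* (t ?∷ ts) ≡ leavesᴹ t + leaves* ts
leaves*-?∷ (just t) ts = refl
leaves*-?∷ nothing  ts = refl

-- Suppressing a vertex above a single child neither loses a set of leaves nor changes the tree that
-- it induces.
∑-inducedTreesᴹ-join : ∀ ts f → ∑ (inducedTreesᴹ (join ts)) f ≡ ∑ (inducedTrees* ts) (f ∘ join)
∑-inducedTreesᴹ-join []           f = refl
∑-inducedTreesᴹ-join (t ∷ [])     f = begin
  ∑ (inducedTrees t) f
    ≡⟨ ∑-cong (inducedTrees t) (λ { (just u) → sym (+-identityʳ _) ; nothing → sym (+-identityʳ _) }) ⟩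
  (∑[ u ∈ inducedTrees t ] ∑[ us ∈ [ [] ] ] f (join (u ?∷ us)))
    ≡⟨ ∑-cartesianProductWith _?∷_ (inducedTrees t) [ [] ] (f ∘ join) ⟨
  ∑ (inducedTrees* (t ∷ [])) (f ∘ join) ∎
  where open ≡-Reasoning
∑-inducedTreesᴹ-join (t ∷ u ∷ ts) f = ∑-map join (inducedTrees* (t ∷ u ∷ ts)) f

∑-inducedTrees*-?∷ : ∀ t ts f → ∑ (inducedTrees* (t ?∷ ts)) f
  ≡ (∑[ u ∈ inducedTreesᴹ t ] ∑[ us ∈ inducedTrees* ts ] f (u ?∷ us))
∑-inducedTrees*-?∷ (just t) ts f = ∑-cartesianProductWith _?∷_ (inducedTrees t) (inducedTrees* ts) f
∑-inducedTrees*-?∷ nothing  ts f = sym (+-identityʳ _)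

-- A subset L of the leaves survives the deletion of each of the n - |L| leaves
-- outside it (with both sides moved so that no subtraction occurs).
mutual
  ∑-deletions : ∀ T f →
    (∑[ U ∈ deletions T ] ∑ (inducedTreesᴹ U) f) + (∑[ U ∈ inducedTrees T ] (leavesᴹ U * f U))
    ≡ leaves T * ∑ (inducedTrees T) f
  ∑-deletions (node [])       f =
    solve 2 (λ x y → y :+ con 0 :+ con 0 :+ (x :+ con 0 :+ con 0) := x :+ (y :+ con 0) :+ con 0)
      refl (f (just (node []))) (f nothing)
    where open +-*-Solver
  ∑-deletions (node (t ∷ ts)) f = begin
    ∑ (map join ds) (λ U → ∑ (inducedTreesᴹ U) f) + ∑ (map join is) (λ U → leavesᴹ U * f U)
      ≡⟨ cong₂ _+_ (∑-map join ds _) (∑-map join is _) ⟩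
    (∑[ us ∈ ds ] ∑ (inducedTreesᴹ (join us)) f) + (∑[ us ∈ is ] (leavesᴹ (join us) * f (join us)))
      ≡⟨ cong₂ _+_ (∑-cong ds (λ us → ∑-inducedTreesᴹ-join us f))
                   (∑-cong is (λ us → cong (_* f (join us)) (leavesᴹ-join us))) ⟩
    (∑[ us ∈ ds ] ∑ (inducedTrees* us) (f ∘ join)) + (∑[ us ∈ is ] (leaves* us * f (join us)))
      ≡⟨ ∑-deletions* (t ∷ ts) (f ∘ join) ⟩
    leaves* (t ∷ ts) * ∑ is (f ∘ join)
      ≡⟨ cong (leaves* (t ∷ ts) *_) (∑-map join is f) ⟨
    leaves* (t ∷ ts) * ∑ (map join is) f ∎
    where
    open ≡-Reasoning
    ds = deletions* (t ∷ ts)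
    is = inducedTrees* (t ∷ ts)

  ∑-deletions* : ∀ ts f →
    (∑[ us ∈ deletions* ts ] ∑ (inducedTrees* us) f) + (∑[ us ∈ inducedTrees* ts ] (leaves* us * f us))
    ≡ leaves* ts * ∑ (inducedTrees* ts) f
  ∑-deletions* []       f = refl
  ∑-deletions* (t ∷ ts) f = begin
    ∑ (map (_?∷ ts) ds ++ map (t ∷_) ds*) (λ us → ∑ (inducedTrees* us) f)
      + ∑ (inducedTrees* (t ∷ ts)) (λ us → leaves* us * f us)
      ≡⟨ cong₂ _+_
           (trans (∑-++ (map (_?∷ ts) ds) _ _) (cong₂ _+_ inHead inTail))
           (trans (∑-cartesianProductWith _?∷_ is is* _) sizes) ⟩
    (D + D*) + (I + I*)
      ≡⟨ solve 4 (λ a b c d → a :+ b :+ (c :+ d) := a :+ c :+ (b :+ d)) refl D D* I I* ⟩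
    (D + I) + (D* + I*)
      -- The deleted leaf lies in `t` or in `ts`. The first case is the induction hypothesis for
      -- `t`, weighted by the sum over `ts`; the second is the one for `ts`, summed over the choices
      -- in `t`.
      ≡⟨ cong₂ _+_ (∑-deletions t (λ u → ∑[ us ∈ is* ] f (u ?∷ us))) tail ⟩
    leaves t * F + leaves* ts * F
      ≡⟨ *-distribʳ-+ F (leaves t) (leaves* ts) ⟨
    leaves* (t ∷ ts) * F
      ≡⟨ cong (leaves* (t ∷ ts) *_) (∑-cartesianProductWith _?∷_ is is* f) ⟨
    leaves* (t ∷ ts) * ∑ (inducedTrees* (t ∷ ts)) f ∎
    where
    open ≡-Reasoning
    open +-*-Solver
    ds  = deletions t
    ds* = deletions* ts
    is  = inducedTrees t
    is* = inducedTrees* ts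
    F   = ∑[ u ∈ is ] ∑[ us ∈ is* ] f (u ?∷ us)
    D   = ∑[ U ∈ ds ] ∑[ u ∈ inducedTreesᴹ U ] ∑[ us ∈ is* ] f (u ?∷ us)
    D*  = ∑[ u ∈ is ] ∑[ vs ∈ ds* ] ∑[ us ∈ inducedTrees* vs ] f (u ?∷ us)
    I   = ∑[ u ∈ is ] (leavesᴹ u * (∑[ us ∈ is* ] f (u ?∷ us)))
    I*  = ∑[ u ∈ is ] ∑[ us ∈ is* ] (leaves* us * f (u ?∷ us))

    inHead : ∑ (map (_?∷ ts) ds) (λ us → ∑ (inducedTrees* us) f) ≡ D
    inHead = trans (∑-map (_?∷ ts) ds _) (∑-cong ds (λ u → ∑-inducedTrees*-?∷ u ts f))

    inTail : ∑ (map (t ∷_) ds*) (λ us → ∑ (inducedTrees* us) f) ≡ D*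
    inTail = trans (∑-map (t ∷_) ds* _)
      (trans (∑-cong ds* (λ vs → ∑-cartesianProductWith _?∷_ is (inducedTrees* vs) f))
             (∑-swap ds* is (λ vs u → ∑[ us ∈ inducedTrees* vs ] f (u ?∷ us))))

    sizes : (∑[ u ∈ is ] ∑[ us ∈ is* ] (leaves* (u ?∷ us) * f (u ?∷ us))) ≡ I + I*
    sizes = trans
      (∑-cong is (λ u → trans
        (∑-cong is* (λ us → trans (cong (_* f (u ?∷ us)) (leaves*-?∷ u us))
                                  (*-distribʳ-+ (f (u ?∷ us)) (leavesᴹ u) (leaves* us))))
        (trans (∑-distrib-+ is* (λ us → leavesᴹ u * f (u ?∷ us)) (λ us → leaves* us * f (u ?∷ us)))
               (cong (_+ (∑[ us ∈ is* ] (leaves* us * f (u ?∷ us))))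
                     (∑-distribˡ-* is* (leavesᴹ u) (λ us → f (u ?∷ us)))))))
      (∑-distrib-+ is _ _)

    tail : D* + I* ≡ leaves* ts * F
    tail = trans (sym (∑-distrib-+ is _ _))
      (trans (∑-cong is (λ u → ∑-deletions* ts (λ us → f (u ?∷ us))))
             (∑-distribˡ-* is (leaves* ts) _))

-- Grafting a tree on every leaf

-- Caterpillars are binary, hence belong to every class considered, and exist with every positive
-- number of leaves.
caterpillar : ℕ → Tree
caterpillar zero    = node []
caterpillar (suc n) = node (node [] ∷ caterpillar n ∷ [])

leaves-caterpillar : ∀ n → leaves (caterpillar n) ≡ suc n
leaves-caterpillar zero    = refl
leaves-caterpillar (suc n) = cong suc (trans (+-identityʳ _) (leaves-caterpillar n))

-- The grafted trees have suc q leaves, so that grafting never loses a leaf.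
mutual
  graft : ℕ → Tree → Tree
  graft q (node [])       = caterpillar q
  graft q (node (t ∷ ts)) = node (graft* q (t ∷ ts))

  graft* : ℕ → List Tree → List Tree
  graft* q []       = []
  graft* q (t ∷ ts) = graft q t ∷ graft* q ts

mutual
  leaves-graft : ∀ q T → leaves (graft q T) ≡ leaves T * suc q
  leaves-graft q (node [])       = trans (leaves-caterpillar q) (sym (*-identityˡ (suc q)))
  leaves-graft q (node (t ∷ ts)) = leaves*-graft q (t ∷ ts)

  leaves*-graft : ∀ q ts → leaves* (graft* q ts) ≡ leaves* ts * suc q
  leaves*-graft q []       = refl
  leaves*-graft q (t ∷ ts) = trans (cong₂ _+_ (leaves-graft q t) (leaves*-graft q ts))
    (sym (*-distribʳ-+ (suc q) (leaves t) (leaves* ts)))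

-- Each of the `suc n` singletons induces the one-vertex tree and the empty set induces nothing; the
-- larger sets only add nonnegative terms.
∑-caterpillar : ∀ n f → suc n * f (just (node [])) + f nothing ≤ ∑ (inducedTrees (caterpillar n)) f
∑-caterpillar zero    f = ≤-reflexive
  (solve 2 (λ x y → x :+ con 0 :+ y := x :+ (y :+ con 0)) refl (f (just (node []))) (f nothing))
  where open +-*-Solver
∑-caterpillar (suc n) f = begin
  suc (suc n) * f ℓ + f nothing
    ≡⟨ +-assoc (f ℓ) (suc n * f ℓ) (f nothing) ⟩
  f ℓ + (suc n * f ℓ + f nothing)
    -- Of the sets containing the first leaf only the singleton is kept; the sets avoiding it are
    -- handled by the induction hypothesis.
    ≤⟨ +-mono-≤ (≤-trans (m≤n+m (f ℓ) _) (∑-caterpillar n (λ u → f (join (node [] ∷ u ?∷ [])))))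
                (≤-trans (∑-caterpillar n f) (≤-reflexive (∑-cong is (λ { (just _) → refl ; nothing → refl })))) ⟩
  (∑[ u ∈ is ] f (join (node [] ∷ u ?∷ []))) + (∑[ u ∈ is ] f (join (u ?∷ [])))
    ≡⟨ cong₂ _+_ (single (node [] ∷_)) (trans (single id) (sym (+-identityʳ _))) ⟩
  (∑[ u ∈ just (node []) ∷ nothing ∷ [] ] ∑[ us ∈ inducedTrees* (caterpillar n ∷ []) ] f (join (u ?∷ us)))
    ≡⟨ ∑-cartesianProductWith _?∷_ (inducedTrees (node [])) (inducedTrees* (caterpillar n ∷ [])) (f ∘ join) ⟨
  ∑ (inducedTrees* (node [] ∷ caterpillar n ∷ [])) (f ∘ join)
    ≡⟨ ∑-map join (inducedTrees* (node [] ∷ caterpillar n ∷ [])) f ⟨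
  ∑ (inducedTrees (caterpillar (suc n))) f ∎
  where
  open ≤-Reasoning
  ℓ  = just (node [])
  is = inducedTrees (caterpillar n)

  single : ∀ (g : List Tree → List Tree) → (∑[ u ∈ is ] f (join (g (u ?∷ []))))
         ≡ (∑[ us ∈ inducedTrees* (caterpillar n ∷ []) ] f (join (g us)))
  single g = sym (trans (∑-cartesianProductWith _?∷_ is [ [] ] (f ∘ join ∘ g))
                        (∑-cong is (λ _ → +-identityʳ _)))

-- A set L of leaves of T lifts in (suc q) ^ |L| ways to a set of leaves of the
-- grafted tree inducing the same tree.
mutual
  ∑-graft : ∀ q T f → (∑[ U ∈ inducedTrees T ] (suc q ^ leavesᴹ U * f U)) ≤ ∑ (inducedTrees (graft q T)) f
  ∑-graft q (node [])       f = ≤-trans (≤-reflexive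
    (solve 3 (λ k x y → k :* con 1 :* x :+ (con 1 :* y :+ con 0) := k :* x :+ y) refl
       (suc q) (f (just (node []))) (f nothing)))
    (∑-caterpillar q f)
    where open +-*-Solver
  ∑-graft q (node (t ∷ ts)) f = begin
    ∑ (map join is) (λ U → suc q ^ leavesᴹ U * f U)
      ≡⟨ ∑-map join is _ ⟩
    (∑[ us ∈ is ] (suc q ^ leavesᴹ (join us) * f (join us)))
      ≡⟨ ∑-cong is (λ us → cong (λ n → suc q ^ n * f (join us)) (leavesᴹ-join us)) ⟩
    (∑[ us ∈ is ] (suc q ^ leaves* us * f (join us)))
      ≤⟨ ∑-graft* q (t ∷ ts) (f ∘ join) ⟩
    ∑ (inducedTrees* (graft* q (t ∷ ts))) (f ∘ join)
      ≡⟨ ∑-map join (inducedTrees* (graft* q (t ∷ ts))) f ⟨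
    ∑ (inducedTrees (graft q (node (t ∷ ts)))) f ∎
    where
    open ≤-Reasoning
    is = inducedTrees* (t ∷ ts)

  ∑-graft* : ∀ q ts f → (∑[ us ∈ inducedTrees* ts ] (suc q ^ leaves* us * f us))
                      ≤ ∑ (inducedTrees* (graft* q ts)) f
  ∑-graft* q []       f = ≤-reflexive (cong (_+ 0) (*-identityˡ (f [])))
  ∑-graft* q (t ∷ ts) f = begin
    ∑ (inducedTrees* (t ∷ ts)) (λ us → suc q ^ leaves* us * f us)
      ≡⟨ ∑-cartesianProductWith _?∷_ is is* _ ⟩
    (∑[ u ∈ is ] ∑[ us ∈ is* ] (suc q ^ leaves* (u ?∷ us) * f (u ?∷ us)))
      ≡⟨ ∑-cong is (λ u → trans (∑-cong is* (split u))
           (∑-distribˡ-* is* (suc q ^ leavesᴹ u) (λ us → suc q ^ leaves* us * f (u ?∷ us)))) ⟩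
    (∑[ u ∈ is ] (suc q ^ leavesᴹ u * (∑[ us ∈ is* ] (suc q ^ leaves* us * f (u ?∷ us)))))
      ≤⟨ ∑-mono is (λ u → *-monoʳ-≤ (suc q ^ leavesᴹ u) (∑-graft* q ts (λ us → f (u ?∷ us)))) ⟩
    (∑[ u ∈ is ] (suc q ^ leavesᴹ u * (∑[ us ∈ inducedTrees* (graft* q ts) ] f (u ?∷ us))))
      ≤⟨ ∑-graft q t _ ⟩
    (∑[ u ∈ inducedTrees (graft q t) ] ∑[ us ∈ inducedTrees* (graft* q ts) ] f (u ?∷ us))
      ≡⟨ ∑-cartesianProductWith _?∷_ (inducedTrees (graft q t)) (inducedTrees* (graft* q ts)) f ⟨
    ∑ (inducedTrees* (graft* q (t ∷ ts))) f ∎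
    where
    open ≤-Reasoning
    is  = inducedTrees t
    is* = inducedTrees* ts

    split : ∀ u us → suc q ^ leaves* (u ?∷ us) * f (u ?∷ us)
                   ≡ suc q ^ leavesᴹ u * (suc q ^ leaves* us * f (u ?∷ us))
    split u us = trans
      (cong (_* f (u ?∷ us)) (trans (cong (suc q ^_) (leaves*-?∷ u us)) (^-distribˡ-+-* (suc q) (leavesᴹ u) _)))
      (*-assoc (suc q ^ leavesᴹ u) _ _)

^leavesᴹ*occurs : ∀ q S U → q ^ leavesᴹ U * occurs S U ≡ q ^ leaves S * occurs S U
^leavesᴹ*occurs q S nothing = trans (*-zeroʳ 1) (sym (*-zeroʳ (q ^ leaves S)))
^leavesᴹ*occurs q S (just U) with U ≅? S
... | yes U≅S = cong (λ n → q ^ n * 1) (leaves-cong U≅S)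
... | no  _   = trans (*-zeroʳ (q ^ leaves U)) (sym (*-zeroʳ (q ^ leaves S)))

-- All copies of `S` have `leaves S` leaves, so the lifting factor is the same for each.
c-graft : ∀ q S T → suc q ^ leaves S * c S T ≤ c S (graft q T)
c-graft q S T = begin
  suc q ^ leaves S * c S T
    ≡⟨ cong (suc q ^ leaves S *_) (c≡∑ S T) ⟩
  suc q ^ leaves S * ∑ (inducedTrees T) (occurs S)
    ≡⟨ ∑-distribˡ-* (inducedTrees T) (suc q ^ leaves S) (occurs S) ⟨
  (∑[ U ∈ inducedTrees T ] (suc q ^ leaves S * occurs S U))
    ≡⟨ ∑-cong (inducedTrees T) (^leavesᴹ*occurs (suc q) S) ⟨
  (∑[ U ∈ inducedTrees T ] (suc q ^ leavesᴹ U * occurs S U))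
    ≤⟨ ∑-graft q T (occurs S) ⟩
  ∑ (inducedTrees (graft q T)) (occurs S)
    ≡⟨ c≡∑ S (graft q T) ⟨
  c S (graft q T) ∎
  where open ≤-Reasoning

-- Classes of trees

mutual
  everyOutdegree? : ∀ {P : ℕ → Set} → (∀ n → Dec (P n)) → ∀ T → Dec (EveryOutdegree P T)
  everyOutdegree? P? (node ts) =
    map′ (λ { (p , ps) → node p ps }) (λ { (node p ps) → p , ps })
         (P? (length ts) ×-dec everyOutdegree*? P? ts)

  everyOutdegree*? : ∀ {P : ℕ → Set} → (∀ n → Dec (P n)) → ∀ ts → Dec (All (EveryOutdegree P) ts)
  everyOutdegree*? P? []       = yes []
  everyOutdegree*? P? (t ∷ ts) =
    map′ (λ { (p , ps) → p ∷ ps }) (λ { (p ∷ ps) → p , ps })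
         (everyOutdegree? P? t ×-dec everyOutdegree*? P? ts)

topological? : ∀ T → Dec (Topological T)
topological? = everyOutdegree? (λ k → ¬? (k ≟ 0) →-dec (2 ≤? k))

ary? : ∀ d T → Dec (Ary d T)
ary? d T = topological? T ×-dec everyOutdegree? (_≤? d) T

-- What topological and d-ary trees have in common as far as deletion and grafting are concerned.
-- Both restrict outdegrees by bounds only, whence `replace`: at least two and at most the former
-- number of children is always allowed.
record IsTreeClass (P : Tree → Set) : Set where
  field
    dec         : ∀ T → Dec (P T)
    topological : ∀ {T} → P T → Topological T
    leaf        : P (node [])
    binary      : ∀ {t u} → P t → P u → P (node (t ∷ u ∷ []))
    children    : ∀ {ts} → P (node ts) → All P ts
    replace     : ∀ {ts u v us} → P (node ts) → All P (u ∷ v ∷ us) →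
                  length (u ∷ v ∷ us) ≤ length ts → P (node (u ∷ v ∷ us))

Topological-isTreeClass : IsTreeClass Topological
Topological-isTreeClass = record
  { dec         = topological?
  ; topological = id
  ; leaf        = node (contradiction refl) []
  ; binary      = λ p q → node (λ _ → s≤s (s≤s z≤n)) (p ∷ q ∷ [])
  ; children    = λ { (node _ ps) → ps }
  ; replace     = λ _ ps _ → node (λ _ → s≤s (s≤s z≤n)) ps
  }

Ary-isTreeClass : ∀ {d} → 2 ≤ d → IsTreeClass (Ary d)
Ary-isTreeClass {d} 2≤d = record
  { dec         = ary? d
  ; topological = proj₁
  ; leaf        = T.leaf , node z≤n []
  ; binary      = λ { (p , p′) (q , q′) → T.binary p q , node 2≤d (p′ ∷ q′ ∷ []) }
  ; children    = λ { (node _ ps , node _ qs) → All.zip (ps , qs) }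
  ; replace     = λ { (p , node n≤d _) pqs m≤n →
                      T.replace p (All.map proj₁ pqs) m≤n , node (≤-trans m≤n n≤d) (All.map proj₂ pqs) }
  }
  where module T = IsTreeClass Topological-isTreeClass

mutual
  -- Every child has a leaf below it, so no outdegree exceeds the number of leaves.
  leaves-Ary : ∀ {d T} → Topological T → leaves T ≤ d → EveryOutdegree (_≤ d) T
  leaves-Ary {T = node []}       (node _ [])  _   = node z≤n []
  leaves-Ary {T = node (t ∷ ts)} (node _ ps) n≤d =
    node (≤-trans (length≤leaves* (t ∷ ts)) n≤d) (leaves*-Ary ps n≤d)

  leaves*-Ary : ∀ {d ts} → All Topological ts → leaves* ts ≤ d → All (EveryOutdegree (_≤ d)) ts
  leaves*-Ary []                 n≤d = []
  leaves*-Ary {ts = t ∷ ts} (p ∷ ps) n≤d =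
    leaves-Ary p (≤-trans (m≤m+n (leaves t) (leaves* ts)) n≤d) ∷
    leaves*-Ary ps (≤-trans (m≤n+m (leaves* ts) (leaves t)) n≤d)

  length≤leaves* : ∀ ts → length ts ≤ leaves* ts
  length≤leaves* []       = z≤n
  length≤leaves* (t ∷ ts) = +-mono-≤ (leaves≥1 t) (length≤leaves* ts)

-- Enumeration of trees and optimal trees

sequences : {A : Set} → ℕ → List A → List (List A)
sequences zero    xs = [ [] ]
sequences (suc n) xs = [] ∷ cartesianProductWith _∷_ xs (sequences n xs)

[]∈sequences : ∀ {A : Set} n {xs : List A} → [] ∈ sequences n xs
[]∈sequences zero    = here refl
[]∈sequences (suc n) = here refl

∈-sequences : ∀ {A : Set} n {xs ys : List A} → All (_∈ xs) ys → length ys ≤ n → ys ∈ sequences n xs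
∈-sequences n       []         _         = []∈sequences n
∈-sequences (suc n) (y∈ ∷ ys∈) (s≤s l≤n) =
  there (∈-cartesianProductWith⁺ _∷_ y∈ (∈-sequences n ys∈ l≤n))

-- `h` bounds the number of levels and `w` the outdegrees. In a topological tree both are at most
-- the number of leaves, so a finite list contains all candidates for the maximum.
trees : ℕ → ℕ → List Tree
trees zero    w = []
trees (suc h) w = map node (sequences w (trees h w))

mutual
  -- A non-leaf vertex has at least two children, so each child has fewer leaves than the whole tree
  -- and the bound on the levels can drop by one.
  ∈-trees : ∀ h {w T} → Topological T → leaves T ≤ h → leaves T ≤ w → T ∈ trees h w
  ∈-trees zero    {T = T} _ n≤0 _ = contradiction (≤-trans (leaves≥1 T) n≤0) λ ()
  ∈-trees (suc h) {w} {node []} _ _ _ = ∈-map⁺ node ([]∈sequences w)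
  ∈-trees (suc h) {T = node (t ∷ [])} (node 2≤1 _) _ _ = contradiction (2≤1 λ ()) λ { (s≤s ()) }
  ∈-trees (suc h) {w} {node (t ∷ u ∷ ts)} (node _ (p ∷ ps)) n≤1+h n≤w =
    ∈-map⁺ node (∈-sequences w
      (∈-trees h p
        (s≤s⁻¹ (≤-trans (m<m+n (leaves t) (leaves≥1 (node (u ∷ ts)))) n≤1+h))
        (≤-trans (m≤m+n (leaves t) (leaves* (u ∷ ts))) n≤w)
      ∷ ∈-trees* h ps
        (s≤s⁻¹ (≤-trans (m<n+m (leaves* (u ∷ ts)) (leaves≥1 t)) n≤1+h))
        (≤-trans (m≤n+m (leaves* (u ∷ ts)) (leaves t)) n≤w))
      (≤-trans (length≤leaves* (t ∷ u ∷ ts)) n≤w))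

  ∈-trees* : ∀ h {w ts} → All Topological ts → leaves* ts ≤ h → leaves* ts ≤ w → All (_∈ trees h w) ts
  ∈-trees* h []                      _   _   = []
  ∈-trees* h {ts = t ∷ ts} (p ∷ ps) n≤h n≤w =
    ∈-trees h p (≤-trans (m≤m+n (leaves t) (leaves* ts)) n≤h) (≤-trans (m≤m+n (leaves t) (leaves* ts)) n≤w) ∷
    ∈-trees* h ps (≤-trans (m≤n+m (leaves* ts) (leaves t)) n≤h) (≤-trans (m≤n+m (leaves* ts) (leaves t)) n≤w)

module TreeClass {P : Tree → Set} (isTreeClass : IsTreeClass P) where
  open IsTreeClass isTreeClass

  caterpillar⁺ : ∀ n → P (caterpillar n)
  caterpillar⁺ zero    = leaf
  caterpillar⁺ (suc n) = binary leaf (caterpillar⁺ n)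

  length-graft* : ∀ q ts → length (graft* q ts) ≡ length ts
  length-graft* q []       = refl
  length-graft* q (t ∷ ts) = cong suc (length-graft* q ts)

  mutual
    graft⁺ : ∀ q {T} → P T → P (graft q T)
    graft⁺ q {node []}           _ = caterpillar⁺ q
    -- `replace` builds vertices with at least two children; a single child is excluded by
    -- topologicality.
    graft⁺ q {node (t ∷ [])}     p with topological p
    ... | node 2≤1 _ = contradiction (2≤1 λ ()) λ { (s≤s ()) }
    graft⁺ q {node (t ∷ u ∷ ts)} p =
      replace p (graft*⁺ q (children p)) (≤-reflexive (length-graft* q (t ∷ u ∷ ts)))

    graft*⁺ : ∀ q {ts} → All P ts → All P (graft* q ts)
    graft*⁺ q []       = []
    graft*⁺ q (p ∷ ps) = graft⁺ q p ∷ graft*⁺ q ps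

  -- A deletion never increases the number of children, so `replace` applies if two remain;
  -- otherwise the vertex disappears and the remaining child, if any, is already in the class.
  join⁺ : ∀ {ts us} → P (node ts) → All P us → length us ≤ length ts → MaybeAll.All P (join us)
  join⁺ p []           _   = MaybeAll.nothing
  join⁺ p (q ∷ [])     _   = MaybeAll.just q
  join⁺ p (q ∷ r ∷ qs) m≤n = MaybeAll.just (replace p (q ∷ r ∷ qs) m≤n)

  mutual
    deletions⁺ : ∀ {T} → P T →
      All (λ U → MaybeAll.All P U × suc (leavesᴹ U) ≡ leaves T) (deletions T)
    deletions⁺ {node []}       p = (MaybeAll.nothing , refl) ∷ []
    deletions⁺ {node (t ∷ ts)} p = All.map⁺ (All.map
      (λ {us} (qs , m≤n , eq) → join⁺ p qs m≤n , trans (cong suc (leavesᴹ-join us)) eq)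
      (deletions*⁺ (children p)))

    deletions*⁺ : ∀ {ts} → All P ts →
      All (λ us → All P us × length us ≤ length ts × suc (leaves* us) ≡ leaves* ts) (deletions* ts)
    deletions*⁺ [] = []
    deletions*⁺ {t ∷ ts} (p ∷ ps) = All.++⁺
      (All.map⁺ (All.map
        (λ { {just u}  (MaybeAll.just q  , eq) → q ∷ ps , ≤-refl , cong (_+ leaves* ts) eq
           ; {nothing} (MaybeAll.nothing , eq) → ps , n≤1+n _ , cong (_+ leaves* ts) eq })
        (deletions⁺ p)))
      (All.map⁺ (All.map
        (λ {us} (qs , m≤n , eq) → p ∷ qs , s≤s m≤n ,
          trans (sym (+-suc (leaves t) (leaves* us))) (cong (leaves t +_) eq))
        (deletions*⁺ ps)))

  -- `∑-deletions` with the weight `occurs S`: each of the `suc n` deletions contributes at most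
  -- `b`, and each copy of `S` is destroyed by `leaves S` of them. That loss stands on the right
  -- instead of being subtracted on the left.
  c-deletions : ∀ S {n b} → 1 ≤ n → (∀ U → P U → leaves U ≡ n → c S U ≤ b) →
                ∀ T → P T → leaves T ≡ suc n → suc n * c S T ≤ suc n * b + leaves S * c S T
  c-deletions S {n} {b} 1≤n bound T p |T|≡1+n = begin
    suc n * c S T
      ≡⟨ cong₂ _*_ (sym |T|≡1+n) (c≡∑ S T) ⟩
    leaves T * ∑ (inducedTrees T) (occurs S)
      ≡⟨ ∑-deletions T (occurs S) ⟨
    (∑[ U ∈ deletions T ] ∑ (inducedTreesᴹ U) (occurs S)) + (∑[ U ∈ inducedTrees T ] (leavesᴹ U * occurs S U))
      ≤⟨ +-mono-≤ (∑-bounded (All.map below (deletions⁺ p)))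
           (≤-reflexive (trans (∑-cong (inducedTrees T) (leavesᴹ*occurs S))
                               (∑-distribˡ-* (inducedTrees T) (leaves S) (occurs S)))) ⟩
    length (deletions T) * b + leaves S * ∑ (inducedTrees T) (occurs S)
      ≡⟨ cong₂ _+_ (cong (_* b) (trans (length-deletions T) |T|≡1+n)) (cong (leaves S *_) (sym (c≡∑ S T))) ⟩
    suc n * b + leaves S * c S T ∎
    where
    open ≤-Reasoning
    below : ∀ {U} → MaybeAll.All P U × suc (leavesᴹ U) ≡ leaves T → ∑ (inducedTreesᴹ U) (occurs S) ≤ b
    below {just U}  (MaybeAll.just q , eq) =
      subst (_≤ b) (c≡∑ S U) (bound U q (suc-injective (trans eq |T|≡1+n)))
    below {nothing} (_ , eq) = contradiction (subst (1 ≤_) (sym (suc-injective (trans eq |T|≡1+n))) 1≤n) λ ()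

  private
    candidates : ℕ → List Tree
    candidates n = filter (λ T → dec T ×-dec leaves T ≟ suc n) (trees (suc n) (suc n))

  -- There are no trees without leaves, hence the shift.
  optimal : Tree → ℕ → Tree
  optimal S n = argmax (c S) (caterpillar n) (candidates n)

  optimal⁺ : ∀ S n → P (optimal S n) × leaves (optimal S n) ≡ suc n
  optimal⁺ S n = argmax-all (c S) {P = λ T → P T × leaves T ≡ suc n}
    (caterpillar⁺ n , leaves-caterpillar n)
    (All.all-filter (λ T → dec T ×-dec leaves T ≟ suc n) (trees (suc n) (suc n)))

  optimal-max : ∀ S n T → P T → leaves T ≡ suc n → c S T ≤ c S (optimal S n)
  optimal-max S n T p eq = All.lookup (f[xs]≤f[argmax] (caterpillar n) (candidates n))
    (∈-filter⁺ (λ T → dec T ×-dec leaves T ≟ suc n)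
      (∈-trees (suc n) (topological p) (≤-reflexive eq) (≤-reflexive eq)) (p , eq))

-- Binomial coefficients

^-distribʳ-* : ∀ k m n → (m * n) ^ k ≡ m ^ k * n ^ k
^-distribʳ-* zero    m n = refl
^-distribʳ-* (suc k) m n = trans (cong (m * n *_) (^-distribʳ-* k m n)) ([m*n]*[o*p]≡[m*o]*[n*p] m n _ _)

-- The absorption identity, by induction with Pascal's rule on both sides.
[1+k]*[1+n]C[1+k]≡[1+n]*nCk : ∀ n k → suc k * (suc n C suc k) ≡ suc n * (n C k)
[1+k]*[1+n]C[1+k]≡[1+n]*nCk zero    zero    = refl
[1+k]*[1+n]C[1+k]≡[1+n]*nCk zero    (suc k) = trans
  (cong (suc (suc k) *_) (k>n⇒nCk≡0 {1} {suc (suc k)} (s≤s (s≤s z≤n))))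
  (trans (*-zeroʳ (suc (suc k))) (sym (cong (1 *_) (k>n⇒nCk≡0 {0} {suc k} (s≤s z≤n)))))
[1+k]*[1+n]C[1+k]≡[1+n]*nCk (suc n) zero    =
  trans (*-identityˡ _) (trans (nC1≡n (suc (suc n))) (sym (*-identityʳ _)))
[1+k]*[1+n]C[1+k]≡[1+n]*nCk (suc n) (suc k) = begin
  suc (suc k) * (suc (suc n) C suc (suc k))
    ≡⟨ cong (suc (suc k) *_) (nCk+nC[k+1]≡[n+1]C[k+1] (suc n) (suc k)) ⟨
  suc (suc k) * (x + y)
    ≡⟨ solve 3 (λ k x y → (con 2 :+ k) :* (x :+ y) := x :+ ((con 1 :+ k) :* x :+ (con 2 :+ k) :* y)) refl k x y ⟩
  x + (suc k * x + suc (suc k) * y)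
    ≡⟨ cong (x +_) (cong₂ _+_ ([1+k]*[1+n]C[1+k]≡[1+n]*nCk n k) ([1+k]*[1+n]C[1+k]≡[1+n]*nCk n (suc k))) ⟩
  x + (suc n * (n C k) + suc n * (n C suc k))
    ≡⟨ cong (x +_) (*-distribˡ-+ (suc n) (n C k) (n C suc k)) ⟨
  x + suc n * (n C k + n C suc k)
    ≡⟨ cong (λ z → x + suc n * z) (nCk+nC[k+1]≡[n+1]C[k+1] n k) ⟩
  suc (suc n) * x ∎
  where
  open ≡-Reasoning
  open +-*-Solver
  x = suc n C suc k
  y = suc n C suc (suc k)

-- The subtraction-free form of `(n + 1 - k) C(n + 1, k) = (n + 1) C(n,
-- k)`, which matches the loss term of `c-deletions`.
[1+n]*[1+n]Ck : ∀ n k → suc n * (suc n C k) ≡ suc n * (n C k) + k * (suc n C k)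
[1+n]*[1+n]Ck n zero    = sym (+-identityʳ _)
[1+n]*[1+n]Ck n (suc k) = begin
  suc n * (suc n C suc k)
    ≡⟨ cong (suc n *_) (trans (sym (nCk+nC[k+1]≡[n+1]C[k+1] n k)) (+-comm (n C k) _)) ⟩
  suc n * (n C suc k + n C k)
    ≡⟨ *-distribˡ-+ (suc n) (n C suc k) (n C k) ⟩
  suc n * (n C suc k) + suc n * (n C k)
    ≡⟨ cong (λ z → suc n * (n C suc k) + z) ([1+k]*[1+n]C[1+k]≡[1+n]*nCk n k) ⟨
  suc n * (n C suc k) + suc k * (suc n C suc k) ∎
  where open ≡-Reasoning

n*nCk : ∀ n k → n * (n C k) ≡ suc k * (n C suc k) + k * (n C k)
n*nCk zero    k       = sym (cong₂ _+_
  (trans (cong (suc k *_) (k>n⇒nCk≡0 {0} {suc k} (s≤s z≤n))) (*-zeroʳ (suc k))) (k*0Ck≡0 k))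
  where
  k*0Ck≡0 : ∀ k → k * (0 C k) ≡ 0
  k*0Ck≡0 zero    = refl
  k*0Ck≡0 (suc k) = trans (cong (suc k *_) (k>n⇒nCk≡0 {0} {suc k} (s≤s z≤n))) (*-zeroʳ (suc k))
n*nCk (suc n) k       = trans ([1+n]*[1+n]Ck n k)
  (cong (_+ k * (suc n C k)) (sym ([1+k]*[1+n]C[1+k]≡[1+n]*nCk n k)))

-- `(n C k) * k !` is the falling factorial `n(n-1)⋯(n-k+1)`; this is its recursion in `k`, with the
-- subtraction moved to the other side.
n*nCk*k! : ∀ n k → n * ((n C k) * k !) ≡ (n C suc k) * suc k ! + k * ((n C k) * k !)
n*nCk*k! n k = begin
  n * ((n C k) * k !)
    ≡⟨ *-assoc n (n C k) (k !) ⟨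
  n * (n C k) * k !
    ≡⟨ cong (_* k !) (n*nCk n k) ⟩
  (suc k * (n C suc k) + k * (n C k)) * k !
    ≡⟨ solve 4 (λ k x y f → ((con 1 :+ k) :* x :+ k :* y) :* f := x :* ((con 1 :+ k) :* f) :+ k :* (y :* f))
         refl k (n C suc k) (n C k) (k !) ⟩
  (n C suc k) * suc k ! + k * ((n C k) * k !) ∎
  where
  open ≡-Reasoning
  open +-*-Solver

nCk*k!≤n^k : ∀ n k → (n C k) * k ! ≤ n ^ k
nCk*k!≤n^k n zero    = ≤-refl
nCk*k!≤n^k n (suc k) = begin
  (n C suc k) * suc k !                        ≤⟨ m≤m+n _ _ ⟩
  (n C suc k) * suc k ! + k * ((n C k) * k !)    ≡⟨ n*nCk*k! n k ⟨
  n * ((n C k) * k !)                            ≤⟨ *-monoʳ-≤ n (nCk*k!≤n^k n k) ⟩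
  n * n ^ k                                    ∎
  where open ≤-Reasoning

-- n(n-1)⋯(n-k+1) ≥ n^k (1 - k²/n)
n*n^k≤ : ∀ n k → n * n ^ k ≤ n * ((n C k) * k !) + k * k * n ^ k
n*n^k≤ n zero    = ≤-reflexive (sym (+-identityʳ _))
n*n^k≤ n (suc k) = begin
  n * (n * n ^ k)
    ≤⟨ *-monoʳ-≤ n (n*n^k≤ n k) ⟩
  n * (n * ((n C k) * k !) + k * k * n ^ k)
    ≡⟨ cong (λ z → n * (z + k * k * n ^ k)) (n*nCk*k! n k) ⟩
  n * (F + k * ((n C k) * k !) + k * k * n ^ k)
    ≤⟨ *-monoʳ-≤ n (+-monoˡ-≤ (k * k * n ^ k) (+-monoʳ-≤ F (*-monoʳ-≤ k (nCk*k!≤n^k n k)))) ⟩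
  n * (F + k * n ^ k + k * k * n ^ k)
    -- Slack that completes the square: `k + k² + (k + 1) = (k + 1)²`.
    ≤⟨ m≤m+n _ (suc k * (n * n ^ k)) ⟩
  n * (F + k * n ^ k + k * k * n ^ k) + suc k * (n * n ^ k)
    ≡⟨ solve 4 (λ n F k e → n :* (F :+ k :* e :+ k :* k :* e) :+ (con 1 :+ k) :* (n :* e)
                         := n :* F :+ (con 1 :+ k) :* (con 1 :+ k) :* (n :* e)) refl n F k (n ^ k) ⟩
  n * F + suc k * suc k * (n * n ^ k) ∎
  where
  open ≤-Reasoning
  open +-*-Solver
  F = (n C suc k) * suc k !

-- Fractions of natural numbers

-- With the junk value ratio p 0 = 0.
ratio : ℕ → ℕ → ℚ
ratio p zero    = 0ℚ
ratio p (suc q) = ℤ.+ p ℚ./ suc q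

/≡ratio : ∀ p q .{{_ : NonZero q}} → ℤ.+ p ℚ./ q ≡ ratio p q
/≡ratio p (suc q) = refl

toℚᵘ-ratio : ∀ p q → ℚ.toℚᵘ (ratio p (suc q)) ℚᵘ.≃ mkℚᵘ (ℤ.+ p) q
toℚᵘ-ratio p q = ℚ.toℚᵘ-fromℚᵘ (mkℚᵘ (ℤ.+ p) q)

+*≤+* : ∀ p q r s → p * s ≤ r * q → ℤ.+ p ℤ.* ℤ.+ s ℤ.≤ ℤ.+ r ℤ.* ℤ.+ q
+*≤+* p q r s le = subst₂ ℤ._≤_ (ℤ.pos-* p s) (ℤ.pos-* r q) (+≤+ le)

ratio-mono : ∀ {p q r s} .{{_ : NonZero q}} .{{_ : NonZero s}} →
             p * s ≤ r * q → ratio p q ℚ.≤ ratio r s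
ratio-mono {p} {suc q} {r} {suc s} le = ℚ.toℚᵘ-cancel-≤
  (ℚᵘ.≤-respˡ-≃ (ℚᵘ.≃-sym (toℚᵘ-ratio p q)) (ℚᵘ.≤-respʳ-≃ (ℚᵘ.≃-sym (toℚᵘ-ratio r s))
    (*≤* (+*≤+* p (suc q) r (suc s) le))))

ratio-+ : ∀ p q r s .{{_ : NonZero q}} .{{_ : NonZero s}} →
          ratio p q ℚ.+ ratio r s ≡ ratio (p * s + r * q) (q * s)
ratio-+ p (suc q) r (suc s) = ℚ.toℚᵘ-injective (ℚᵘ.≃-trans
  (ℚ.toℚᵘ-homo-+ (ratio p (suc q)) (ratio r (suc s)))
  (ℚᵘ.≃-trans (ℚᵘ.+-cong (toℚᵘ-ratio p q) (toℚᵘ-ratio r s))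
    (ℚᵘ.≃-trans (ℚᵘ.≃-reflexive (cong (λ z → mkℚᵘ z (s + q * suc s)) eq))
                (ℚᵘ.≃-sym (toℚᵘ-ratio (p * suc s + r * suc q) (s + q * suc s))))))
  where
  eq : ℤ.+ p ℤ.* ℤ.+ suc s ℤ.+ ℤ.+ r ℤ.* ℤ.+ suc q ≡ ℤ.+ (p * suc s + r * suc q)
  eq = cong₂ ℤ._+_ (sym (ℤ.pos-* p (suc s))) (sym (ℤ.pos-* r (suc q)))

0≤ratio : ∀ p q → 0ℚ ℚ.≤ ratio p q
0≤ratio p zero    = ℚ.≤-refl
0≤ratio p (suc q) = ratio-mono {0} {1} {p} {suc q} z≤n

archimedean : ∀ K N₀ {ε} → 0ℚ ℚ.< ε → ∃[ N ] N₀ ≤ N × ratio K N ℚ.≤ ε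
-- Here `ε` is `(p + 1)/(q + 1)`, so `K * suc q ≤ suc p * N` is required. The summand `N₀` secures
-- the lower bound and the successor a positive denominator.
archimedean K N₀ {mkℚ (ℤ.+ suc p) q _} _ = suc (K * suc q + N₀) , m≤n⇒m≤1+n (m≤n+m N₀ _) ,
  ℚ.toℚᵘ-cancel-≤ (ℚᵘ.≤-respˡ-≃ (ℚᵘ.≃-sym (toℚᵘ-ratio K (K * suc q + N₀)))
    (*≤* (+*≤+* K (suc (K * suc q + N₀)) (suc p) (suc q) le)))
  where
  le : K * suc q ≤ suc p * suc (K * suc q + N₀)
  le = ≤-trans (≤-trans (m≤m+n (K * suc q) N₀) (n≤1+n _)) (m≤m+n (suc (K * suc q + N₀)) _)
archimedean K N₀ {mkℚ (ℤ.+ zero) q c} 0<ε =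
  contradiction (ℚ.positive 0<ε) λ ()
archimedean K N₀ {mkℚ (ℤ.-[1+ p ]) q _} 0<ε =
  contradiction (ℚ.positive 0<ε) λ ()

-- Absolute values and limits

halve : ∀ {ε} → 0ℚ ℚ.< ε → ∃[ δ ] 0ℚ ℚ.< δ × δ ℚ.+ δ ≡ ε
halve {ε} 0<ε = ½ ℚ.* ε , ℚ.positive⁻¹ (½ ℚ.* ε) {{ℚ.pos*pos⇒pos ½ ε {{ℚ.positive 0<ε}}}} ,
  trans (sym (ℚ.*-distribʳ-+ ε ½ ½)) (ℚ.*-identityˡ ε)

p≤q+r⇒p-q≤r : ∀ {p q r} → p ℚ.≤ q ℚ.+ r → p ℚ.- q ℚ.≤ r
p≤q+r⇒p-q≤r {p} {q} {r} p≤q+r = ℚ.≤-trans (ℚ.+-monoˡ-≤ (ℚ.- q) p≤q+r)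
  (ℚ.≤-reflexive (solve 2 (λ q r → q :+ r :- q := r) refl q r))
  where open ℚ-Solver

∣p-q∣≤r : ∀ {p q r} → p ℚ.≤ q ℚ.+ r → q ℚ.≤ p ℚ.+ r → ℚ.∣ p ℚ.- q ∣ ℚ.≤ r
∣p-q∣≤r {p} {q} {r} p≤q+r q≤p+r with ℚ.∣p∣≡p∨∣p∣≡-p (p ℚ.- q)
... | inj₁ eq rewrite eq = p≤q+r⇒p-q≤r p≤q+r
... | inj₂ eq rewrite eq = ℚ.≤-trans
  (ℚ.≤-reflexive (solve 2 (λ p q → :- (p :- q) := q :- p) refl p q)) (p≤q+r⇒p-q≤r q≤p+r)
  where open ℚ-Solver

p≤∣p∣ : ∀ p → p ℚ.≤ ℚ.∣ p ∣
p≤∣p∣ p with ℚ.≤-total 0ℚ p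
... | inj₁ 0≤p = ℚ.≤-reflexive (sym (ℚ.0≤p⇒∣p∣≡p 0≤p))
... | inj₂ p≤0 = ℚ.≤-trans p≤0 (ℚ.0≤∣p∣ p)

∣p-q∣≡∣q-p∣ : ∀ p q → ℚ.∣ p ℚ.- q ∣ ≡ ℚ.∣ q ℚ.- p ∣
∣p-q∣≡∣q-p∣ p q = trans (sym (ℚ.∣-p∣≡∣p∣ (p ℚ.- q)))
  (cong ℚ.∣_∣ (solve 2 (λ p q → :- (p :- q) := q :- p) refl p q))
  where open ℚ-Solver

-- The order on the reals demands a positive margin; one half of `ε` bounds the distance and the
-- other half is the margin.
isLimit : ∀ x → IsLimit (fromℚ ∘ seq x) x
isLimit x ε 0<ε with halve 0<ε
... | δ , 0<δ , refl with cauchy x δ 0<δ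
... | N , close = N , λ m N≤m → δ , 0<δ , N , λ n N≤n →
  ℚ.+-monoˡ-≤ δ (ℚ.<⇒≤ (close m n N≤m N≤n))

-- `J` is defined by a limit superior, whereas the maximal densities are shown to converge.
limit⇒limsup : ∀ a ℓ → IsLimit a ℓ → IsLimsup a ℓ
limit⇒limsup a ℓ a→ℓ ε 0<ε with a→ℓ ε 0<ε
... | N , close = (N , λ n N≤n → above n (close n N≤n)) ,
  λ M → M ⊔ N , m≤m⊔n M N , below (M ⊔ N) (close (M ⊔ N) (m≤n⊔m M N))
  where
  above : ∀ n → ∣ a n - ℓ ∣ < fromℚ ε → a n - ℓ < fromℚ ε
  above n (δ , 0<δ , K , le) = δ , 0<δ , K , λ k K≤k →
    ℚ.≤-trans (ℚ.+-monoˡ-≤ δ (p≤∣p∣ (seq (a n) k ℚ.- seq ℓ k))) (le k K≤k)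

  below : ∀ n → ∣ a n - ℓ ∣ < fromℚ ε → ℓ - a n < fromℚ ε
  below n (δ , 0<δ , K , le) = δ , 0<δ , K , λ k K≤k →
    ℚ.≤-trans (ℚ.+-monoˡ-≤ δ (ℚ.≤-trans (p≤∣p∣ (seq ℓ k ℚ.- seq (a n) k))
                (ℚ.≤-reflexive (∣p-q∣≡∣q-p∣ (seq ℓ k) (seq (a n) k)))))
              (le k K≤k)

-- Maximal densities

c≤length-subsets : ∀ S T → c S T ≤ length (subsets (leaves T))
c≤length-subsets S T = length-filter (λ L → MaybeAny.dec (_≅? S) (induced T L)) (subsets (leaves T))

-- The constant `K` of the rate `K/m`, with `k = leaves S`: `k²` stems from the estimate of the
-- falling factorial, and the number `2^k` of all sets of `k` leaves is an upper bound for the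
-- density. It does not depend on the class.
error : Tree → ℕ
error S = leaves S * leaves S * length (subsets (leaves S))

module Density {P : Tree → Set} (isTreeClass : IsTreeClass P) where
  open TreeClass isTreeClass

  maxCount : Tree → ℕ → ℕ
  maxCount S zero    = 0
  maxCount S (suc n) = c S (optimal S n)

  c≤maxCount : ∀ S T → P T → c S T ≤ maxCount S (leaves T)
  c≤maxCount S T p = go (leaves T) refl
    where
    go : ∀ n → leaves T ≡ n → c S T ≤ maxCount S n
    go zero    eq = contradiction (subst (1 ≤_) eq (leaves≥1 T)) λ ()
    go (suc n) eq = optimal-max S n T p eq

  maxDensity : Tree → ℕ → ℚ
  maxDensity S n = ratio (maxCount S n) (n C leaves S)

  -- `ratio` carries no proof of a nonzero denominator, so `leaves T` can be replaced in it by an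
  -- equal number.
  γ≡ratio : ∀ S T (S≤T : leaves S ≤ leaves T) → γ S T S≤T ≡ ratio (c S T) (leaves T C leaves S)
  γ≡ratio S T S≤T = /≡ratio (c S T) (leaves T C leaves S) {{nCk≢0 S≤T}}

  maxDensity-isMax : ∀ S → IsMaxDensitySequence P S (maxDensity S)
  maxDensity-isMax S zero    |S|≤0 = contradiction (≤-trans (leaves≥1 S) |S|≤0) λ ()
  maxDensity-isMax S (suc n) |S|≤n =
    (optimal S n , proj₁ (optimal⁺ S n) , eq , S≤T ,
      trans (γ≡ratio S (optimal S n) S≤T) (cong (λ m → ratio (c S (optimal S n)) (m C leaves S)) eq)) ,
    λ T p |T|≡ S≤T → subst (ℚ._≤ maxDensity S (suc n)) (sym (γ≡ratio S T S≤T))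
      (subst (λ m → ratio (c S T) (m C leaves S) ℚ.≤ maxDensity S (suc n)) (sym |T|≡)
        (ratio-mono {{nCk≢0 |S|≤n}} {{nCk≢0 |S|≤n}}
          (*-monoˡ-≤ (suc n C leaves S) (optimal-max S n T p |T|≡))))
    where
    eq  = proj₂ (optimal⁺ S n)
    S≤T = subst (leaves S ≤_) (sym eq) |S|≤n

  -- Averaging over the deletions of one leaf.
  maxCount-suc : ∀ S n → leaves S ≤ n →
    maxCount S (suc n) * (n C leaves S) ≤ maxCount S n * (suc n C leaves S)
  maxCount-suc S zero      |S|≤0 = contradiction (≤-trans (leaves≥1 S) |S|≤0) λ ()
  maxCount-suc S n@(suc m) |S|≤n = *-cancelˡ-≤ (suc n) (+-cancelʳ-≤ (k * (x * C′)) _ _ (begin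
    suc n * (x * (n C k)) + k * (x * C′)
      ≡⟨ solve 5 (λ n x C k C′ → n :* (x :* C) :+ k :* (x :* C′) := x :* (n :* C :+ k :* C′))
           refl (suc n) x (n C k) k C′ ⟩
    -- The summand `k * (x * C′)`, added on both sides, completes the factor of `x` to `suc n * C′`;
    -- the averaging inequality returns the same summand, which then cancels.
    x * (suc n * (n C k) + k * C′)
      ≡⟨ cong (x *_) ([1+n]*[1+n]Ck n k) ⟨
    x * (suc n * C′)
      ≡⟨ solve 3 (λ n x C′ → x :* (n :* C′) := C′ :* (n :* x)) refl (suc n) x C′ ⟩
    C′ * (suc n * x)
      ≤⟨ *-monoʳ-≤ C′ (c-deletions S (s≤s z≤n) (optimal-max S m) (optimal S n)
           (proj₁ (optimal⁺ S n)) (proj₂ (optimal⁺ S n))) ⟩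
    C′ * (suc n * y + k * x)
      ≡⟨ solve 5 (λ n x C′ k y → C′ :* (n :* y :+ k :* x) := n :* (y :* C′) :+ k :* (x :* C′))
           refl (suc n) x C′ k y ⟩
    suc n * (y * C′) + k * (x * C′) ∎))
    where
    open ≤-Reasoning
    open +-*-Solver
    k  = leaves S
    x  = maxCount S (suc n)
    y  = maxCount S n
    C′ = suc n C k

  maxCount-mono : ∀ S {m n} → leaves S ≤ m → m ≤ n →
    maxCount S n * (m C leaves S) ≤ maxCount S m * (n C leaves S)
  maxCount-mono S {m} |S|≤m m≤n = go (≤⇒≤′ m≤n)
    where
    k = leaves S

    go : ∀ {n} → m ≤′ n → maxCount S n * (m C k) ≤ maxCount S m * (n C k)
    go ≤′-refl = ≤-refl
    go {suc n} (≤′-step m≤′n) = *-cancelʳ-≤ _ _ (n C k) {{nCk≢0 |S|≤n}} (begin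
      maxCount S (suc n) * (m C k) * (n C k)
        ≡⟨ xy∙z≈xz∙y (maxCount S (suc n)) _ _ ⟩
      maxCount S (suc n) * (n C k) * (m C k)
        ≤⟨ *-monoˡ-≤ (m C k) (maxCount-suc S n |S|≤n) ⟩
      maxCount S n * (suc n C k) * (m C k)
        ≡⟨ xy∙z≈xz∙y (maxCount S n) _ _ ⟩
      maxCount S n * (m C k) * (suc n C k)
        ≤⟨ *-monoˡ-≤ (suc n C k) (go m≤′n) ⟩
      maxCount S m * (n C k) * (suc n C k)
        ≡⟨ xy∙z≈xz∙y (maxCount S m) _ _ ⟩
      maxCount S m * (suc n C k) * (n C k) ∎)
      where
      open ≤-Reasoning
      |S|≤n = ≤-trans |S|≤m (≤′⇒≤ m≤′n)

  maxDensity-mono : ∀ S {m n} → leaves S ≤ m → m ≤ n → maxDensity S n ℚ.≤ maxDensity S m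
  maxDensity-mono S |S|≤m m≤n =
    ratio-mono {{nCk≢0 (≤-trans |S|≤m m≤n)}} {{nCk≢0 |S|≤m}} (maxCount-mono S |S|≤m m≤n)

  maxCount≤ : ∀ S n → maxCount S n ≤ length (subsets n)
  maxCount≤ S zero    = z≤n
  maxCount≤ S (suc n) = subst (λ m → maxCount S (suc n) ≤ length (subsets m))
    (proj₂ (optimal⁺ S n)) (c≤length-subsets S (optimal S n))

  -- By monotonicity the density is at most its value at `leaves S`, where the binomial coefficient
  -- is 1 and the count is at most the number of all sets.
  maxCount≤*C : ∀ S {n} → leaves S ≤ n → maxCount S n ≤ length (subsets (leaves S)) * (n C leaves S)
  maxCount≤*C S {n} |S|≤n = begin
    maxCount S n                                   ≡⟨ *-identityʳ _ ⟨
    maxCount S n * 1                               ≡⟨ cong (maxCount S n *_) (nCn≡1 (leaves S)) ⟨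
    maxCount S n * (leaves S C leaves S)           ≤⟨ maxCount-mono S ≤-refl |S|≤n ⟩
    maxCount S (leaves S) * (n C leaves S)         ≤⟨ *-monoˡ-≤ (n C leaves S) (maxCount≤ S (leaves S)) ⟩
    length (subsets (leaves S)) * (n C leaves S)   ∎
    where open ≤-Reasoning

  maxCount-* : ∀ S n q → suc q ^ leaves S * maxCount S (suc n) ≤ maxCount S (suc n * suc q)
  maxCount-* S n q = ≤-trans (c-graft q S (optimal S n))
    (subst (λ m → c S (graft q (optimal S n)) ≤ maxCount S m)
      (trans (leaves-graft q (optimal S n)) (cong (_* suc q) (proj₂ (optimal⁺ S n))))
      (c≤maxCount S (graft q (optimal S n)) (graft⁺ q (proj₁ (optimal⁺ S n)))))

  -- Grafting multiplies the count by at least `q^k`, whereas the binomial coefficient grows at most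
  -- by the factor `q^k / (1 - k²/n)` if `k² < n`. The proof cross-multiplies and scales by `n^k`,
  -- so that falling factorials are compared with powers.
  maxDensity-≤-* : ∀ S n q → leaves S ≤ suc n →
    maxDensity S (suc n) ℚ.≤ maxDensity S (suc n * suc q) ℚ.+ ratio (error S) (suc n)
  maxDensity-≤-* S n′ q′ |S|≤n = subst (maxDensity S n ℚ.≤_)
    (sym (ratio-+ y D (error S) n {{D≢0}}))
    (ratio-mono {{nCk≢0 |S|≤n}} {{m*n≢0 D n {{D≢0}}}}
      (*-cancelˡ-≤ (n ^ k) {{m^n≢0 n k}} (begin
        n ^ k * (x * (D * n))
          ≡⟨ solve 4 (λ e x D n → e :* (x :* (D :* n)) := x :* D :* (n :* e)) refl (n ^ k) x D n ⟩
        x * D * (n * n ^ k)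
          ≤⟨ *-monoʳ-≤ (x * D) (n*n^k≤ n k) ⟩
        x * D * (n * (E * k !) + k * k * n ^ k)
          ≡⟨ solve 7 (λ x D n E f k e → x :* D :* (n :* (E :* f) :+ k :* k :* e)
                        := x :* n :* E :* (D :* f) :+ k :* k :* x :* D :* e) refl x D n E (k !) k (n ^ k) ⟩
        x * n * E * (D * k !) + k * k * x * D * n ^ k
          -- In the leading term the falling factorial of `n * q` is at most its power; in the error
          -- term `x` is at most `B * E`.
          ≤⟨ +-mono-≤ (*-monoʳ-≤ (x * n * E) (nCk*k!≤n^k (n * q) k))
               (*-monoˡ-≤ (n ^ k) (*-monoˡ-≤ D (*-monoʳ-≤ (k * k) (maxCount≤*C S |S|≤n)))) ⟩
        x * n * E * (n * q) ^ k + k * k * (B * E) * D * n ^ k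
          ≡⟨ cong (λ z → x * n * E * z + k * k * (B * E) * D * n ^ k) (^-distribʳ-* k n q) ⟩
        x * n * E * (n ^ k * q ^ k) + k * k * (B * E) * D * n ^ k
          ≡⟨ solve 8 (λ x n E e f k B D → x :* n :* E :* (e :* f) :+ k :* k :* (B :* E) :* D :* e
                        := e :* ((f :* x :* n :+ k :* k :* B :* D) :* E))
               refl x n E (n ^ k) (q ^ k) k B D ⟩
        n ^ k * ((q ^ k * x * n + error S * D) * E)
          ≤⟨ *-monoʳ-≤ (n ^ k) (*-monoˡ-≤ E (+-monoˡ-≤ (error S * D) (*-monoˡ-≤ n (maxCount-* S n′ q′)))) ⟩
        n ^ k * ((y * n + error S * D) * E) ∎)))
    where
    open ≤-Reasoning
    open +-*-Solver
    k = leaves S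
    n = suc n′
    q = suc q′
    x = maxCount S n
    y = maxCount S (n * q)
    D = n * q C k
    E = n C k
    B = length (subsets k)

    D≢0 : NonZero D
    D≢0 = nCk≢0 (≤-trans |S|≤n (m≤m*n n q))

  -- The larger index itself serves as the grafting factor: the resulting multiple of `m` is at
  -- least that index, so monotonicity finishes the comparison.
  maxDensity-≤ : ∀ S {m n} → leaves S ≤ m → m ≤ n →
    maxDensity S m ℚ.≤ maxDensity S n ℚ.+ ratio (error S) m
  maxDensity-≤ S {zero}  |S|≤0 _   = contradiction (≤-trans (leaves≥1 S) |S|≤0) λ ()
  maxDensity-≤ S {m@(suc m′)} {suc n} |S|≤m m≤n = ℚ.≤-trans (maxDensity-≤-* S m′ n |S|≤m)
    (ℚ.+-monoˡ-≤ (ratio (error S) m) (maxDensity-mono S (≤-trans |S|≤m m≤n) (m≤n*m (suc n) m)))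

  limit : Tree → ℝ
  seq    (limit S) = maxDensity S
  cauchy (limit S) ε 0<ε with halve 0<ε
  -- Halving `ε` turns the weak bound by `δ` into the strict bound required.
  ... | δ , 0<δ , refl with archimedean (error S) (leaves S) 0<δ
  ... | N , |S|≤N , err≤δ = N , λ m n N≤m N≤n → ℚ.≤-<-trans
    (∣p-q∣≤r (near m n N≤m N≤n) (near n m N≤n N≤m))
    (ℚ.≤-<-trans err≤δ (subst (ℚ._< δ ℚ.+ δ) (ℚ.+-identityʳ δ) (ℚ.+-monoʳ-< δ 0<δ)))
    where
    near : ∀ m n → N ≤ m → N ≤ n → maxDensity S m ℚ.≤ maxDensity S n ℚ.+ ratio (error S) N
    -- Both indices are compared with `N`: `a(m) ≤ a(N) ≤ a(n) + K/N`.
    near m n N≤m N≤n = ℚ.≤-trans (maxDensity-mono S |S|≤N N≤m) (maxDensity-≤ S |S|≤N N≤n)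

-- Comparison of two classes

module _ {P Q : Tree → Set} (P-isTreeClass : IsTreeClass P) (Q-isTreeClass : IsTreeClass Q) where
  private
    module P = Density P-isTreeClass
    module Q = Density Q-isTreeClass
  open TreeClass P-isTreeClass using (optimal; optimal⁺)
  open TreeClass Q-isTreeClass using (optimal-max)

  -- An optimal tree of `P` competes in `Q`. Inclusion is asked for at `n` leaves only, because
  -- topological trees are guaranteed to be d-ary only up to `d` leaves.
  maxDensity-⊆ : ∀ S {n} → leaves S ≤ n → (∀ {T} → P T → leaves T ≡ n → Q T) →
                 P.maxDensity S n ℚ.≤ Q.maxDensity S n
  maxDensity-⊆ S {zero}  |S|≤0 _   = contradiction (≤-trans (leaves≥1 S) |S|≤0) λ ()
  maxDensity-⊆ S {suc n} |S|≤n P⊆Q with optimal⁺ S n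
  ... | p , eq = ratio-mono {{nCk≢0 |S|≤n}} {{nCk≢0 |S|≤n}}
    (*-monoˡ-≤ (suc n C leaves S) (optimal-max S n (optimal S n) (P⊆Q p eq) eq))

-- Inducibility in topological and in d-ary trees

module TopologicalDensity = Density Topological-isTreeClass
module AryDensity {d} (2≤d : 2 ≤ d) = Density (Ary-isTreeClass 2≤d)

inducibility : Tree → ℝ
inducibility = TopologicalDensity.limit

-- Taking the decision as an argument makes this a total sequence in `d`, with the default 0 for
-- `d < 2`.
aryInducibility : Tree → ∀ {d} → Dec (2 ≤ d) → ℝ
aryInducibility S (yes 2≤d) = AryDensity.limit 2≤d S
aryInducibility S (no  _)   = fromℚ 0ℚ

inducibility-isInducibility : ∀ S → IsInducibility S (inducibility S)
inducibility-isInducibility S =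
  TopologicalDensity.maxDensity S , TopologicalDensity.maxDensity-isMax S ,
  limit⇒limsup (fromℚ ∘ TopologicalDensity.maxDensity S) (inducibility S) (isLimit (inducibility S))

aryInducibility-isAryInducibility : ∀ S {d} (2≤d? : Dec (2 ≤ d)) → 2 ≤ d →
                                    IsAryInducibility d S (aryInducibility S 2≤d?)
aryInducibility-isAryInducibility S (yes 2≤d) _   =
  AryDensity.maxDensity 2≤d S , AryDensity.maxDensity-isMax 2≤d S , isLimit (AryDensity.limit 2≤d S)
aryInducibility-isAryInducibility S (no  2≰d) 2≤d = contradiction 2≤d 2≰d

-- With `A` for topological and `a` for d-ary maxima, `a(n) ≤ A(n)` by inclusion. Conversely
-- `A(n) ≤ A(N) ≤ a(N) ≤ a(n) + K/N`, where the middle step uses `N ≤ d`. The bound is independent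
-- of `d` and `n`.
aryInducibility-close : ∀ S {N d n} (2≤d? : Dec (2 ≤ d)) → 2 ≤ d →
  leaves S ≤ N → N ≤ d → N ≤ n →
  ℚ.∣ seq (aryInducibility S 2≤d?) n ℚ.- TopologicalDensity.maxDensity S n ∣ ℚ.≤ ratio (error S) N
aryInducibility-close S {N} {d} {n} (yes 2≤d) _ |S|≤N N≤d N≤n = ∣p-q∣≤r
  (ℚ.≤-trans
    (maxDensity-⊆ (Ary-isTreeClass 2≤d) Topological-isTreeClass S |S|≤n (λ p _ → proj₁ p))
    p≤p+ratio)
  (ℚ.≤-trans (TopologicalDensity.maxDensity-mono S |S|≤N N≤n)
    (ℚ.≤-trans
      (maxDensity-⊆ Topological-isTreeClass (Ary-isTreeClass 2≤d) S |S|≤N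
        (λ p |T|≡N → p , leaves-Ary p (≤-trans (≤-reflexive |T|≡N) N≤d)))
      (AryDensity.maxDensity-≤ 2≤d S |S|≤N N≤n)))
  where
  |S|≤n = ≤-trans |S|≤N N≤n

  p≤p+ratio : ∀ {p} → p ℚ.≤ p ℚ.+ ratio (error S) N
  p≤p+ratio {p} = subst (ℚ._≤ p ℚ.+ ratio (error S) N) (ℚ.+-identityʳ p)
    (ℚ.+-monoʳ-≤ p (0≤ratio (error S) N))
aryInducibility-close S (no 2≰d) 2≤d _ _ _ = contradiction 2≤d 2≰d

theorem7 : (S : Tree) → Topological S →
    Σ[ J ∈ ℝ ] Σ[ I ∈ (ℕ → ℝ) ] (IsInducibility S J
    × (∀ (d : ℕ) → 2 ≤ d → Ary d S → IsAryInducibility d S (I d))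
    × IsLimit I J)
theorem7 S _ = inducibility S , (λ d → aryInducibility S (2 ≤? d)) ,
  inducibility-isInducibility S ,
  (λ d 2≤d _ → aryInducibility-isAryInducibility S (2 ≤? d) 2≤d) ,
  converges
  where
  converges : IsLimit (λ d → aryInducibility S (2 ≤? d)) (inducibility S)
  converges ε 0<ε with halve 0<ε
  ... | δ , 0<δ , refl with archimedean (error S) (leaves S ⊔ 2) 0<δ
  -- The same `N` bounds the arity `d` and the index `n` from below; being at least `leaves S ⊔ 2`,
  -- it makes the densities meaningful and puts `d` in the range of the d-ary classes. The second
  -- half of `ε` is the margin.
  ... | N , ≤N , err≤δ = N , λ d N≤d → δ , 0<δ , N , λ n N≤n → ℚ.+-monoˡ-≤ δ (ℚ.≤-trans
    (aryInducibility-close S (2 ≤? d) (≤-trans (m⊔n≤o⇒n≤o (leaves S) 2 ≤N) N≤d)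
      (m⊔n≤o⇒m≤o (leaves S) 2 ≤N) N≤d N≤n)
    err≤δ)
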